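{- Let $\mu$ and $\lambda$ be strict partitions. Then (a) if $\mu\not\subset\lambda$ (i.e. $\mu_i>\lambda_i$ for some $i$), then $P^*_\mu(\lambda)=0$; (b) $P^*_\mu(\mu)=H(\mu)$, where $$H(\mu)=\prod_{t=1}^{l(\mu)}\mu_t!\prod_{1\le i<j\le l(\mu)}\frac{\mu_i+\mu_j}{\mu_i-\mu_j}.$$
   Context: A partition is strict if its nonzero parts are distinct; $l(\lambda)$ is the number of nonzero parts, and $\lambda_i=0$ for $i>l(\lambda)$. Let $(x\downharpoonright k)=\prod_{i=1}^k(x-i+1)$ for $k\ge1$, $(x\downharpoonright0)=1$. For a strict partition $\mu$ with $l=l(\mu)\le n$, $$P^*_{\mu|n}(x_1,\ldots,x_n)=\frac{1}{(n-l)!}\sum_{\omega\in S(n)}\Big(\prod_{i=1}^l (x_{\omega(i)}\downharpoonright\mu_i)\prod_{i\le l,\ i<j\le n}\frac{x_{\omega(i)}+x_{\omega(j)}}{x_{\omega(i)}-x_{\omega(j)}}\Big)$$ (a polynomial), and $P^*_{\mu|n}=0$ if $l(\mu)>n$. These satisfy $P^*_{\mu|n+1}(x_1,\ldots,x_n,0)=P^*_{\mu|n}(x_1,\ldots,x_n)$. For a partition $\lambda$, $P^*_\mu(\lambda)$ denotes $P^*_{\mu|n}(\lambda_1,\ldots,\lambda_n)$ for any $n\ge\max(l(\lambda),l(\mu))$ (independent of such $n$). For partitions, $\mu\subset\lambda$ means $\mu_i\le\lambda_i$ for all $i$. -}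

module Defs where

open import Data.Nat as ℕ using (ℕ; zero; suc; _<_; _⊔_; _∸_)
open import Data.Nat using (_!)
open import Data.Integer using (+_)
open import Data.Rational using (ℚ; 0ℚ; 1ℚ; _+_; _*_; _-_; _/_; 1/_; ≢-nonZero)
open import Data.Rational.Properties using (_≟_)
open import Data.List using (List; []; _∷_; length; map; foldr; concatMap; upTo; _++_; drop)
open import Data.List.Relation.Unary.All using (All)
open import Data.List.Relation.Unary.Linked using (Linked)
open import Data.Product using (_×_)
open import Relation.Nullary using (yes; no)

-- Partitions are represented by the list of their nonzero parts
-- (weakly decreasing); λ_i = 0 beyond the length.

IsStrict : List ℕ → Set
IsStrict xs = All (0 <_) xs × Linked ℕ._>_ xs

-- i-th part, 0-indexed (so `part λ i` is λ_{i+1}), 0 past the end.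
part : List ℕ → ℕ → ℕ
part []       _       = 0
part (x ∷ _)  zero    = x
part (_ ∷ xs) (suc i) = part xs i

_⊂_ : List ℕ → List ℕ → Set
μ ⊂ lam = ∀ i → part μ i ℕ.≤ part lam i

ℕ→ℚ : ℕ → ℚ
ℕ→ℚ n = + n / 1

-- division; q is always nonzero where it is used (the dummy value 0 for
-- q = 0 is never reached in the definitions below)
_÷'_ : ℚ → ℚ → ℚ
p ÷' q with q ≟ 0ℚ
... | yes _  = 0ℚ
... | no q≢0 = p * (1/_ q {{≢-nonZero q≢0}})

sumℚ : List ℚ → ℚ
sumℚ = foldr _+_ 0ℚ

prodℚ : List ℚ → ℚ
prodℚ = foldr _*_ 1ℚ

fall : ℚ → ℕ → ℚ
fall x k = prodℚ (map (λ i → x - ℕ→ℚ i) (upTo k))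

insertions : ℕ → List ℕ → List (List ℕ)
insertions a []       = (a ∷ []) ∷ []
insertions a (b ∷ bs) = (a ∷ b ∷ bs) ∷ map (b ∷_) (insertions a bs)

perms : List ℕ → List (List ℕ)
perms []       = [] ∷ []
perms (a ∷ as) = concatMap (insertions a) (perms as)

-- S(n) as the list of permutations ω of {0,…,n-1}, ω(i) = part ω i
Sym : ℕ → List (List ℕ)
Sym n = perms (upTo n)

-- The defining formula of P*_{μ|n}, evaluated at a point
-- x = (x_0, …, x_{n-1}) (given as a function ℕ → ℚ; 0-indexed).
-- It is a genuine evaluation only when the x_i are pairwise distinct.

summand : List ℕ → ℕ → (ℕ → ℚ) → List ℕ → ℚ
summand μ n x ω =
  prodℚ (map (λ i → fall (x (part ω i)) (part μ i)) (upTo l))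
  * prodℚ (map (λ i → prodℚ (map (λ j →
        (x (part ω i) + x (part ω j)) ÷' (x (part ω i) - x (part ω j)))
        (drop (suc i) (upTo n))))
      (upTo l))
  where l = length μ

formula : List ℕ → ℕ → (ℕ → ℚ) → ℚ
formula μ n x with n ℕ.<? length μ
... | yes _ = 0ℚ
... | no  _ = (1ℚ ÷' ℕ→ℚ ((n ∸ length μ) !))
              * sumℚ (map (summand μ n x) (Sym n))

-- P*_μ(λ) = P*_{μ|n}(λ_1, …, λ_n) with n = max(l(λ), l(μ)).
--
-- The point (λ_1,…,λ_k,0,…,0) (k = l(λ), m = n - k trailing zeros) has
-- repeated coordinates when m ≥ 2, so the polynomial P*_{μ|n} is evaluated
-- there as follows: g(t) = P*_{μ|n}(λ_1,…,λ_k, t, 2t, …, mt) is a polynomial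
-- in t of degree ≤ |μ| (P*_{μ|n} has degree ≤ |μ|), and for t > λ_1 all
-- coordinates are distinct, so g(t) is given by the defining formula there.
-- We recover g(0) by Lagrange interpolation at the |μ|+1 nodes
-- t_a = T + a (a = 0..|μ|), T = λ_1 + 1:
--     g(0) = Σ_a g(t_a) ∏_{b ≠ a} t_b / (t_b - t_a).

pointAt : List ℕ → ℚ → ℕ → ℚ
pointAt lam t i with i ℕ.<? length lam
... | yes _ = ℕ→ℚ (part lam i)
... | no  _ = t * ℕ→ℚ (suc (i ∸ length lam))

sizeℕ : List ℕ → ℕ
sizeℕ = foldr ℕ._+_ 0

lagrangeAt0 : (ℕ → ℚ) → ℕ → (ℚ → ℚ) → ℚ
lagrangeAt0 node d g =
  sumℚ (map (λ a → g (node a) * prodℚ (map (weight a) (others a))) (upTo (suc d)))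
  where
  others : ℕ → List ℕ
  others a = filterNot a (upTo (suc d))
    where
    filterNot : ℕ → List ℕ → List ℕ
    filterNot a [] = []
    filterNot a (b ∷ bs) with a ℕ.≟ b
    ... | yes _ = filterNot a bs
    ... | no  _ = b ∷ filterNot a bs
  weight : ℕ → ℕ → ℚ
  weight a b = node b ÷' (node b - node a)

Pstar : List ℕ → List ℕ → ℚ
Pstar μ lam = lagrangeAt0 (λ a → ℕ→ℚ (suc (part lam 0) ℕ.+ a)) (sizeℕ μ)
              (λ t → formula μ n (pointAt lam t))
  where n = length lam ⊔ length μ

H : List ℕ → ℚ
H μ = prodℚ (map (λ t → ℕ→ℚ (part μ t !)) (upTo l))
      * prodℚ (map (λ i → prodℚ (map (λ j →
            (ℕ→ℚ (part μ i) + ℕ→ℚ (part μ j)) ÷' (ℕ→ℚ (part μ i) - ℕ→ℚ (part μ j)))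
            (drop (suc i) (upTo l))))
          (upTo l))
  where l = length μ

{-# OPTIONS --safe #-}
module Submission where

-- When n = l(μ), the product over pairs is antisymmetric up to the symmetric
-- factor ∏(x_i + x_j), so the defining sum equals
-- ∏_{i<j} (x_i + x_j)/(x_i - x_j) · det(x_j ↓ μ_i). At x = μ this determinant is
-- triangular, which gives H(μ). If μ_i > λ_i and l(μ) ≤ l(λ), every summand at
-- x = λ vanishes: a permutation ω sends some j ≤ i to ω(j) ≥ i, and then
-- λ_{ω(j)} ≤ λ_i < μ_i ≤ μ_j.
-- If l(μ) > l(λ), then (x ↓ μ_i) is divisible by x, and column operations replace
-- the determinant by ∏ x_j · ∏_{i<j} (x_j - x_i) times a determinant of Newton
-- divided differences. The differences cancel the denominators, so along the
-- line (λ, t, 2t, …, mt) the defining sum is a polynomial in t of degree ≤ |μ| with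
-- the factor x_{k+1} = t, and its interpolated value at t = 0 is 0.
open import Defs
open import Data.Nat using (ℕ; _<_)
open import Data.List using (List)
open import Data.Rational using (0ℚ)
open import Data.Product using (_×_; ∃)
open import Relation.Binary.PropositionalEquality using (_≡_)
open import Data.Nat as ℕ using (zero; suc; s≤s; z≤n; _∸_; _>_; _⊔_; _!)
import Data.Nat.Properties as ℕ
open import Data.Nat.Tactic.RingSolver using (solve-∀)
import Data.Integer as ℤ
import Data.Integer.Properties as ℤ
open import Data.Fin using (Fin; toℕ; fromℕ<)
open import Data.Fin.Properties using (pigeonhole; any?; toℕ-fromℕ<; toℕ<n)
open import Data.List using ([]; _∷_; _++_; map; concatMap; drop; length; upTo; applyUpTo)
open import Data.List.Properties using (length-upTo; length-applyUpTo; map-upTo; drop-map)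
open import Data.List.Relation.Unary.All as All using (All; []; _∷_)
open import Data.List.Relation.Unary.All.Properties using (concat⁺; map⁺; drop⁺; all-upTo; applyUpTo⁺₁)
open import Data.List.Relation.Unary.AllPairs using (AllPairs; []; _∷_)
import Data.List.Relation.Unary.AllPairs.Properties as AllPairs
open import Data.List.Relation.Unary.Any using (Any; here; there)
import Data.List.Relation.Unary.Any.Properties as Any
open import Data.List.Relation.Unary.Linked.Properties using (Linked⇒AllPairs)
open import Data.List.Relation.Unary.Unique.Propositional using (Unique)
open import Data.List.Relation.Unary.Unique.Propositional.Properties using (upTo⁺)
open import Data.List.Relation.Binary.Permutation.Propositional using (_↭_; refl; prep; swap; ↭-sym; ↭-trans; ↭⇒↭ₛ)
open import Data.List.Relation.Binary.Permutation.Propositional.Properties using (All-resp-↭; ↭-length)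
open import Data.Rational using (ℚ; 1ℚ; _+_; _*_; _-_; -_; 1/_; ≢-nonZero)
open import Data.Rational.Properties using (_≟_; *-inverseˡ; *-inverseʳ; *-assoc; *-comm; *-zeroˡ; *-zeroʳ; *-identityˡ; *-identityʳ; +-assoc; +-comm; +-identityˡ; +-identityʳ; toℚᵘ-injective; fromℚᵘ-injective; toℚᵘ-fromℚᵘ; toℚᵘ-homo-+; toℚᵘ-homo-*)
open import Data.Rational.Solver using (module +-*-Solver)
open import Data.Rational.Unnormalised using (mkℚᵘ; *≡*)
import Data.Rational.Unnormalised.Properties as ℚᵘ
open import Data.Product using (_,_; ∃₂; Σ-syntax; proj₁; proj₂)
open import Data.Sum using (_⊎_; inj₁; inj₂)
open import Data.Unit using (⊤)
open import Data.Empty using (⊥)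
open import Function using (_∘_)
open import Relation.Nullary using (yes; no; ¬_; contradiction)
open import Relation.Binary.PropositionalEquality using (_≢_; _≗_; refl; sym; trans; cong; cong₂; subst; setoid; module ≡-Reasoning)
open import Data.List.Relation.Binary.Permutation.Setoid.Properties (setoid ℕ) using (Unique-resp-↭)
open import Algebra.Properties.CommutativeSemigroup ℕ.+-commutativeSemigroup using (interchange; x∙yz≈y∙xz)
open +-*-Solver using (solve; _:+_; _:*_; _:-_; :-_; con; _:=_)
open ≡-Reasoning

-- Rational arithmetic: the embedding of the natural numbers, and division

ℕ→ℚ-+ : ∀ a b → ℕ→ℚ (a ℕ.+ b) ≡ ℕ→ℚ a + ℕ→ℚ b
ℕ→ℚ-+ a b = toℚᵘ-injective (ℚᵘ.≃-trans (toℚᵘ-fromℚᵘ (mkℚᵘ (ℤ.+ (a ℕ.+ b)) 0)) (ℚᵘ.≃-trans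
  (*≡* (cong₂ ℤ._*_ (cong₂ ℤ._+_ (sym (ℤ.*-identityʳ (ℤ.+ a))) (sym (ℤ.*-identityʳ (ℤ.+ b)))) refl))
  (ℚᵘ.≃-sym (ℚᵘ.≃-trans (toℚᵘ-homo-+ (ℕ→ℚ a) (ℕ→ℚ b))
    (ℚᵘ.+-cong (toℚᵘ-fromℚᵘ (mkℚᵘ (ℤ.+ a) 0)) (toℚᵘ-fromℚᵘ (mkℚᵘ (ℤ.+ b) 0)))))))

ℕ→ℚ-* : ∀ a b → ℕ→ℚ (a ℕ.* b) ≡ ℕ→ℚ a * ℕ→ℚ b
ℕ→ℚ-* a b = toℚᵘ-injective (ℚᵘ.≃-trans (toℚᵘ-fromℚᵘ (mkℚᵘ (ℤ.+ (a ℕ.* b)) 0)) (ℚᵘ.≃-trans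
  (*≡* (cong₂ ℤ._*_ (ℤ.pos-* a b) refl))
  (ℚᵘ.≃-sym (ℚᵘ.≃-trans (toℚᵘ-homo-* (ℕ→ℚ a) (ℕ→ℚ b))
    (ℚᵘ.*-cong (toℚᵘ-fromℚᵘ (mkℚᵘ (ℤ.+ a) 0)) (toℚᵘ-fromℚᵘ (mkℚᵘ (ℤ.+ b) 0)))))))

ℕ→ℚ-injective : ∀ {a b} → ℕ→ℚ a ≡ ℕ→ℚ b → a ≡ b
ℕ→ℚ-injective {a} {b} eq with fromℚᵘ-injective {mkℚᵘ (ℤ.+ a) 0} {mkℚᵘ (ℤ.+ b) 0} eq
... | *≡* e = ℤ.+-injective (trans (sym (ℤ.*-identityʳ (ℤ.+ a))) (trans e (ℤ.*-identityʳ (ℤ.+ b))))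

*-cancelʳ : ∀ {p q r} → r ≢ 0ℚ → p * r ≡ q * r → p ≡ q
*-cancelʳ {p} {q} {r} r≢0 eq = begin
  p                   ≡⟨ *-identityʳ p ⟨
  p * 1ℚ              ≡⟨ cong (p *_) (*-inverseʳ r) ⟨
  p * (r * 1/ r)      ≡⟨ *-assoc p r (1/ r) ⟨
  p * r * 1/ r        ≡⟨ cong (_* 1/ r) eq ⟩
  q * r * 1/ r        ≡⟨ *-assoc q r (1/ r) ⟩
  q * (r * 1/ r)      ≡⟨ cong (q *_) (*-inverseʳ r) ⟩
  q * 1ℚ              ≡⟨ *-identityʳ q ⟩
  q                   ∎
  where instance _ = ≢-nonZero r≢0

÷'-*-cancel : ∀ p {q} → q ≢ 0ℚ → (p ÷' q) * q ≡ p
÷'-*-cancel p {q} q≢0 with q ≟ 0ℚ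
... | yes q≡0 = contradiction q≡0 q≢0
... | no q≢0 = trans (*-assoc p (1/ q) q) (trans (cong (p *_) (*-inverseˡ q)) (*-identityʳ p))
  where instance _ = ≢-nonZero q≢0

x-y≡0⇒x≡y : ∀ {x y} → x - y ≡ 0ℚ → x ≡ y
x-y≡0⇒x≡y {x} {y} eq = begin
  x            ≡⟨ solve 2 (λ x y → x := x :- y :+ y) refl x y ⟩
  x - y + y    ≡⟨ cong (_+ y) eq ⟩
  0ℚ + y       ≡⟨ +-identityˡ y ⟩
  y            ∎

-- The dummy value 0 for a zero divisor is its own negative, so the pair factors are antisymmetric
-- at every point, repeated coordinates included.
÷'-neg : ∀ p q → p ÷' (- q) ≡ - (p ÷' q)
÷'-neg p q with q ≟ 0ℚ
... | yes refl = refl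
... | no q≢0 = *-cancelʳ -q≢0 (begin
  (p ÷' (- q)) * - q          ≡⟨ ÷'-*-cancel p -q≢0 ⟩
  p                           ≡⟨ *-identityʳ p ⟨
  p * 1ℚ                      ≡⟨ cong (p *_) (*-inverseˡ q) ⟨
  p * (1/ q * q)              ≡⟨ solve 3 (λ p i q → p :* (i :* q) := (:- (p :* i)) :* (:- q)) refl p (1/ q) q ⟩
  - (p * 1/ q) * - q          ∎)
  where
  instance _ = ≢-nonZero q≢0
  -q≢0 : - q ≢ 0ℚ
  -q≢0 eq = q≢0 (trans (solve 1 (λ q → q := :- (:- q)) refl q) (cong -_ eq))

-- Finite sums and products over lists

∑ ∏ : {A : Set} → List A → (A → ℚ) → ℚ
∑ xs f = sumℚ (map f xs)
∏ xs f = prodℚ (map f xs)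

module _ {A : Set} where

  ∑-cong : ∀ {xs} {f g : A → ℚ} → All (λ x → f x ≡ g x) xs → ∑ xs f ≡ ∑ xs g
  ∑-cong [] = refl
  ∑-cong (eq ∷ eqs) = cong₂ _+_ eq (∑-cong eqs)

  ∏-cong : ∀ {xs} {f g : A → ℚ} → All (λ x → f x ≡ g x) xs → ∏ xs f ≡ ∏ xs g
  ∏-cong [] = refl
  ∏-cong (eq ∷ eqs) = cong₂ _*_ eq (∏-cong eqs)

  ∑-*ˡ : ∀ c xs (f : A → ℚ) → ∑ xs (λ x → c * f x) ≡ c * ∑ xs f
  ∑-*ˡ c [] f = sym (*-zeroʳ c)
  ∑-*ˡ c (x ∷ xs) f = trans (cong (c * f x +_) (∑-*ˡ c xs f))
    (solve 3 (λ c a b → c :* a :+ c :* b := c :* (a :+ b)) refl c (f x) (∑ xs f))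

  ∑-+ : ∀ xs (f g : A → ℚ) → ∑ xs (λ x → f x + g x) ≡ ∑ xs f + ∑ xs g
  ∑-+ [] f g = refl
  ∑-+ (x ∷ xs) f g = trans (cong (f x + g x +_) (∑-+ xs f g))
    (solve 4 (λ a b c d → a :+ b :+ (c :+ d) := a :+ c :+ (b :+ d)) refl (f x) (g x) (∑ xs f) (∑ xs g))

  ∑-zero : ∀ {xs} {f : A → ℚ} → All (λ x → f x ≡ 0ℚ) xs → ∑ xs f ≡ 0ℚ
  ∑-zero [] = refl
  ∑-zero (eq ∷ eqs) = cong₂ _+_ eq (∑-zero eqs)

  ∏-* : ∀ xs (f g : A → ℚ) → ∏ xs (λ x → f x * g x) ≡ ∏ xs f * ∏ xs g
  ∏-* [] f g = refl
  ∏-* (x ∷ xs) f g = trans (cong (f x * g x *_) (∏-* xs f g))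
    (solve 4 (λ a b c d → a :* b :* (c :* d) := a :* c :* (b :* d)) refl (f x) (g x) (∏ xs f) (∏ xs g))

  ∏-zero : ∀ {xs} {f : A → ℚ} → Any (λ x → f x ≡ 0ℚ) xs → ∏ xs f ≡ 0ℚ
  ∏-zero {x ∷ xs} {f} (here fx≡0) = trans (cong (_* ∏ xs f) fx≡0) (*-zeroˡ (∏ xs f))
  ∏-zero {x ∷ xs} {f} (there any) = trans (cong (f x *_) (∏-zero any)) (*-zeroʳ (f x))

  ∑-++ : ∀ xs ys (f : A → ℚ) → ∑ (xs ++ ys) f ≡ ∑ xs f + ∑ ys f
  ∑-++ [] ys f = sym (+-identityˡ (∑ ys f))
  ∑-++ (x ∷ xs) ys f = trans (cong (f x +_) (∑-++ xs ys f)) (sym (+-assoc (f x) (∑ xs f) (∑ ys f)))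

  ∑-concatMap : ∀ {B : Set} (h : B → List A) xs (f : A → ℚ) → ∑ (concatMap h xs) f ≡ ∑ xs (λ x → ∑ (h x) f)
  ∑-concatMap h [] f = refl
  ∑-concatMap h (x ∷ xs) f = trans (∑-++ (h x) (concatMap h xs) f) (cong (∑ (h x) f +_) (∑-concatMap h xs f))

  ∑-map : ∀ {B : Set} (h : B → A) xs (f : A → ℚ) → ∑ (map h xs) f ≡ ∑ xs (f ∘ h)
  ∑-map h [] f = refl
  ∑-map h (x ∷ xs) f = cong (f (h x) +_) (∑-map h xs f)

  ∏-map : ∀ {B : Set} (h : B → A) xs (f : A → ℚ) → ∏ (map h xs) f ≡ ∏ xs (f ∘ h)
  ∏-map h [] f = refl
  ∏-map h (x ∷ xs) f = cong (f (h x) *_) (∏-map h xs f)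

-- Lagrange interpolation

-- Polynomial functions of degree less than `n`, in Horner form: a degree bound d reads
-- `Poly (suc d)`, and `Poly 0` is the zero function.
Poly : ℕ → (ℚ → ℚ) → Set
Poly zero f = ∀ t → f t ≡ 0ℚ
Poly (suc n) f = ∃₂ λ c g → Poly n g × (∀ t → f t ≡ c + t * g t)

module Interpolation (node : ℕ → ℚ) (node-injective : ∀ {a b} → node a ≡ node b → a ≡ b) where

  -- The diagonal weight is set to 1, so that products run over the full list of nodes and induction
  -- on that list does not meet the filter of `lagrangeAt0`.
  w : ℕ → ℕ → ℚ
  w a b with a ℕ.≟ b
  ... | yes _ = 1ℚ
  ... | no _ = node b ÷' (node b - node a)

  L : List ℕ → (ℚ → ℚ) → ℚ
  L as f = ∑ as (λ a → f (node a) * ∏ as (w a))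

  w-refl : ∀ a → w a a ≡ 1ℚ
  w-refl a with a ℕ.≟ a
  ... | yes _ = refl
  ... | no a≢a = contradiction refl a≢a

  w-≢ : ∀ {s a} → s ≢ a → (node a - node s) * w a s ≡ - node s
  w-≢ {s} {a} s≢a with a ℕ.≟ s
  ... | yes a≡s = contradiction (sym a≡s) s≢a
  ... | no _ = begin
    (node a - node s) * (node s ÷' (node s - node a))
      ≡⟨ solve 3 (λ a s q → (a :- s) :* q := :- (q :* (s :- a))) refl (node a) (node s) _ ⟩
    - ((node s ÷' (node s - node a)) * (node s - node a))
      ≡⟨ cong -_ (÷'-*-cancel (node s) (λ eq → s≢a (node-injective (x-y≡0⇒x≡y eq)))) ⟩
    - node s ∎

  L-cong : ∀ as {f g : ℚ → ℚ} → (∀ t → f t ≡ g t) → L as f ≡ L as g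
  L-cong as eq = ∑-cong (All.universal (λ a → cong (_* ∏ as (w a)) (eq (node a))) as)

  L-+ : ∀ as f g → L as (λ t → f t + g t) ≡ L as f + L as g
  L-+ as f g = trans
    (∑-cong (All.universal (λ a → solve 3 (λ a b c → (a :+ b) :* c := a :* c :+ b :* c) refl (f (node a)) (g (node a)) (∏ as (w a))) as))
    (∑-+ as _ _)

  L-* : ∀ as c f → L as (λ t → c * f t) ≡ c * L as f
  L-* as c f = trans (∑-cong (All.universal (λ a → *-assoc c (f (node a)) (∏ as (w a))) as)) (∑-*ˡ c as _)

  -- The term of the node s vanishes. At any other node a, the factor t - node s cancels the
  -- denominator of `w a s` and leaves - node s. A root at a node thus removes that node from the
  -- interpolation.
  L-root : ∀ {s as} f → All (s ≢_) as → L (s ∷ as) (λ t → (t - node s) * f t) ≡ - node s * L as f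
  L-root {s} {as} f s≢as = begin
    (node s - node s) * f (node s) * P s + ∑ as (λ a → (node a - node s) * f (node a) * P a)
      ≡⟨ cong₂ _+_ (solve 3 (λ s f p → (s :- s) :* f :* p := con 0ℚ) refl (node s) (f (node s)) (P s)) refl ⟩
    0ℚ + ∑ as (λ a → (node a - node s) * f (node a) * P a)
      ≡⟨ +-identityˡ _ ⟩
    ∑ as (λ a → (node a - node s) * f (node a) * P a)
      ≡⟨ ∑-cong (All.map (λ {a} s≢a → term s≢a) s≢as) ⟩
    ∑ as (λ a → - node s * (f (node a) * ∏ as (w a)))
      ≡⟨ ∑-*ˡ (- node s) as _ ⟩
    - node s * L as f ∎
    where
    P : ℕ → ℚ
    P a = ∏ (s ∷ as) (w a)
    term : ∀ {a} → s ≢ a → (node a - node s) * f (node a) * P a ≡ - node s * (f (node a) * ∏ as (w a))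
    term {a} s≢a = trans
      (solve 4 (λ d f w p → d :* f :* (w :* p) := d :* w :* (f :* p)) refl (node a - node s) (f (node a)) (w a s) _)
      (cong (_* (f (node a) * ∏ as (w a))) (w-≢ s≢a))

  L-swap : ∀ s u as f → L (s ∷ u ∷ as) f ≡ L (u ∷ s ∷ as) f
  L-swap s u as f = trans
    (∑-cong (All.universal (λ a → cong (f (node a) *_)
      (solve 3 (λ x y z → x :* (y :* z) := y :* (x :* z)) refl (w a s) (w a u) (∏ as (w a)))) (s ∷ u ∷ as)))
    (solve 3 (λ x y z → x :+ (y :+ z) := y :+ (x :+ z)) refl (T s) (T u) (∑ as T))
    where
    T : ℕ → ℚ
    T a = f (node a) * ∏ (u ∷ s ∷ as) (w a)

  -- Neville's recursion: u - s = (t - s) - (t - u).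
  L-one : ∀ {s as} → Unique (s ∷ as) → L (s ∷ as) (λ _ → 1ℚ) ≡ 1ℚ
  L-one {s} {[]} _ = cong (λ z → 1ℚ * (z * 1ℚ) + 0ℚ) (w-refl s)
  L-one {s} {u ∷ as} ((s≢u ∷ s≢as) ∷ (u≢as ∷ as!)) = *-cancelʳ
    (λ eq → s≢u (node-injective (sym (x-y≡0⇒x≡y eq)))) (begin
      I * (nu - ns)
        ≡⟨ *-comm I _ ⟩
      (nu - ns) * I
        ≡⟨ L-* sua (nu - ns) (λ _ → 1ℚ) ⟨
      L sua (λ t → (nu - ns) * 1ℚ)
        ≡⟨ L-cong sua (λ t → solve 3 (λ t u s → (u :- s) :* con 1ℚ := (t :- s) :* con 1ℚ :+ con (- 1ℚ) :* ((t :- u) :* con 1ℚ)) refl t nu ns) ⟩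
      L sua (λ t → (t - ns) * 1ℚ + - 1ℚ * ((t - nu) * 1ℚ))
        ≡⟨ trans (L-+ sua p q) (cong ((L sua p) +_) (L-* sua (- 1ℚ) (λ t → (t - nu) * 1ℚ))) ⟩
      L sua (λ t → (t - ns) * 1ℚ) + - 1ℚ * L sua (λ t → (t - nu) * 1ℚ)
        ≡⟨ cong₂ (λ a b → a + - 1ℚ * b)
             (trans (L-root (λ _ → 1ℚ) (s≢u ∷ s≢as)) (cong (- ns *_) (L-one (u≢as ∷ as!))))
             (trans (L-swap s u as (λ t → (t - nu) * 1ℚ)) (trans (L-root (λ _ → 1ℚ) ((s≢u ∘ sym) ∷ u≢as)) (cong (- nu *_) (L-one (s≢as ∷ as!))))) ⟩
      - ns * 1ℚ + - 1ℚ * (- nu * 1ℚ)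
        ≡⟨ solve 2 (λ u s → :- s :* con 1ℚ :+ con (- 1ℚ) :* (:- u :* con 1ℚ) := con 1ℚ :* (u :- s)) refl nu ns ⟩
      1ℚ * (nu - ns) ∎)
    where
    ns = node s
    nu = node u
    sua = s ∷ u ∷ as
    I = L sua (λ _ → 1ℚ)
    p q : ℚ → ℚ
    p t = (t - ns) * 1ℚ
    q t = - 1ℚ * ((t - nu) * 1ℚ)

  -- With f = c + t g and t = (t - s) + s, `L-root` turns (t - s) g into -s times the interpolation
  -- of g at the remaining nodes. By induction both interpolations of g equal g(0), so the two
  -- contributions cancel and c = f(0) remains.
  L-poly : ∀ {n f as} → Poly n f → Unique as → n ℕ.≤ length as → L as f ≡ f 0ℚ
  L-poly {zero} {f} {as} f≡0 _ _ = trans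
    (∑-zero (All.universal (λ a → trans (cong (_* ∏ as (w a)) (f≡0 (node a))) (*-zeroˡ (∏ as (w a)))) as))
    (sym (f≡0 0ℚ))
  L-poly {suc n} {f} {s ∷ as} (c , g , pg , f≡) (s≢as ∷ as!) (s≤s n≤) = begin
    L sa f
      ≡⟨ L-cong sa (λ t → trans (f≡ t)
           (solve 4 (λ c t g s → c :+ t :* g := c :* con 1ℚ :+ ((t :- s) :* g :+ s :* g)) refl c t (g t) ns)) ⟩
    L sa (λ t → c * 1ℚ + ((t - ns) * g t + ns * g t))
      ≡⟨ trans (L-+ sa (λ _ → c * 1ℚ) (λ t → p t + ns * g t)) (cong₂ _+_ (L-* sa c (λ _ → 1ℚ)) (trans (L-+ sa p (λ t → ns * g t)) (cong ((L sa p) +_) (L-* sa ns g)))) ⟩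
    c * L sa (λ _ → 1ℚ) + (L sa (λ t → (t - ns) * g t) + ns * L sa g)
      ≡⟨ cong₂ (λ x y → c * x + (y + ns * L sa g)) (L-one (s≢as ∷ as!)) (L-root g s≢as) ⟩
    c * 1ℚ + (- ns * L as g + ns * L sa g)
      ≡⟨ cong₂ (λ x y → c * 1ℚ + (- ns * x + ns * y)) (L-poly pg as! n≤) (L-poly pg (s≢as ∷ as!) (ℕ.m≤n⇒m≤1+n n≤)) ⟩
    c * 1ℚ + (- ns * g 0ℚ + ns * g 0ℚ)
      ≡⟨ solve 3 (λ c s g → c :* con 1ℚ :+ (:- s :* g :+ s :* g) := c :+ con 0ℚ :* g) refl c ns (g 0ℚ) ⟩
    c + 0ℚ * g 0ℚ
      ≡⟨ f≡ 0ℚ ⟨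
    f 0ℚ ∎
    where
    ns = node s
    sa = s ∷ as
    p : ℚ → ℚ
    p t = (t - ns) * g t

  -- The witness is found by unification and gives a handle on the products of the local weights.
  lagrangeAt0-weights : (d : ℕ) (g : ℚ → ℚ) → Σ[ P ∈ (ℕ → ℚ) ]
    lagrangeAt0 node d g ≡ ∑ (upTo (suc d)) (λ a → g (node a) * P a)
  lagrangeAt0-weights d g = _ , refl

  -- The local functions of lagrangeAt0 cannot be named here: the left-hand
  -- side of product-others is inferred from its use in weights-product.
  mutual
    weights-product : ∀ d g a → proj₁ (lagrangeAt0-weights d g) a ≡ ∏ (upTo (suc d)) (w a)
    weights-product d g a with a ℕ.≟ 0 | applyUpTo suc d
    ... | yes _ | bs = trans (product-others d g a bs) (sym (*-identityˡ _))
    ... | no _ | bs = cong ((node 0 ÷' (node 0 - node a)) *_) (product-others d g a bs)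

    product-others : ∀ d g a bs → _ ≡ ∏ bs (w a)
    product-others d g a [] = refl
    product-others d g a (b ∷ bs) with a ℕ.≟ b
    ... | yes _ = trans (product-others d g a bs) (sym (*-identityˡ _))
    ... | no _ = cong ((node b ÷' (node b - node a)) *_) (product-others d g a bs)

  -- Agreement is demanded at the nodes alone, because elsewhere, notably at t = 0, the defining
  -- formula may take dummy values of the division.
  lagrangeAt0-poly : ∀ {d f g} → Poly (suc d) f → (∀ a → g (node a) ≡ f (node a)) → lagrangeAt0 node d g ≡ f 0ℚ
  lagrangeAt0-poly {d} {f} {g} pf g≡f = trans (proj₂ (lagrangeAt0-weights d g)) (trans
    (∑-cong (All.universal (λ a → cong₂ _*_ (g≡f a) (weights-product d g a)) (upTo (suc d))))
    (L-poly pf (upTo⁺ (suc d)) (ℕ.≤-reflexive (sym (length-upTo (suc d))))))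

-- Symmetrization and determinants

-- Contraction of the alternating form φ with the linear form c: iterating it
-- is the Laplace expansion of a determinant along successive columns.
module _ {R : Set} where

  E : (R → ℚ) → (List R → ℚ) → List R → ℚ
  E c φ [] = 0ℚ
  E c φ (r ∷ rs) = c r * φ rs - E c (φ ∘ (r ∷_)) rs

  -- The empty determinant. Leftover rows give 0 here, and missing rows give 0 in `E`, so a `Chain`
  -- is nonzero only for square matrices.
  ε : List R → ℚ
  ε [] = 1ℚ
  ε (_ ∷ _) = 0ℚ

  E-cong : ∀ {c d φ ψ} → c ≗ d → φ ≗ ψ → E c φ ≗ E d ψ
  E-cong c≗d φ≗ψ [] = refl
  E-cong c≗d φ≗ψ (r ∷ rs) = cong₂ _-_ (cong₂ _*_ (c≗d r) (φ≗ψ rs)) (E-cong c≗d (φ≗ψ ∘ (r ∷_)) rs)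

  E-linear : ∀ c k φ ψ rs → E c (λ s → φ s + k * ψ s) rs ≡ E c φ rs + k * E c ψ rs
  E-linear c k φ ψ [] = solve 1 (λ k → con 0ℚ := con 0ℚ :+ k :* con 0ℚ) refl k
  E-linear c k φ ψ (r ∷ rs) = trans (cong (λ z → c r * (φ rs + k * ψ rs) - z) (E-linear c k (φ ∘ (r ∷_)) (ψ ∘ (r ∷_)) rs))
    (solve 6 (λ c k f g a b → c :* (f :+ k :* g) :- (a :+ k :* b) := c :* f :- a :+ k :* (c :* g :- b)) refl
      (c r) k (φ rs) (ψ rs) (E c (φ ∘ (r ∷_)) rs) (E c (ψ ∘ (r ∷_)) rs))

  E-zero : ∀ c rs → E c (λ _ → 0ℚ) rs ≡ 0ℚ
  E-zero c [] = refl
  E-zero c (r ∷ rs) = cong₂ _-_ (*-zeroʳ (c r)) (E-zero c rs)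

  E-scale : ∀ c k φ rs → E c (λ s → k * φ s) rs ≡ k * E c φ rs
  E-scale c k φ rs = begin
    E c (λ s → k * φ s) rs               ≡⟨ E-cong {c = c} (λ _ → refl) (λ s → sym (+-identityˡ (k * φ s))) rs ⟩
    E c (λ s → 0ℚ + k * φ s) rs          ≡⟨ E-linear c k (λ _ → 0ℚ) φ rs ⟩
    E c (λ _ → 0ℚ) rs + k * E c φ rs     ≡⟨ cong (_+ k * E c φ rs) (E-zero c rs) ⟩
    0ℚ + k * E c φ rs                    ≡⟨ +-identityˡ (k * E c φ rs) ⟩
    k * E c φ rs                         ∎

  E-∑ : ∀ {A : Set} c (xs : List A) (φ : A → List R → ℚ) rs → E c (λ s → ∑ xs (λ x → φ x s)) rs ≡ ∑ xs (λ x → E c (φ x) rs)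
  E-∑ c [] φ rs = E-zero c rs
  E-∑ c (x ∷ xs) φ rs = begin
    E c (λ s → φ x s + ∑ xs (λ x → φ x s)) rs
      ≡⟨ E-cong {c = c} (λ _ → refl) (λ s → cong (φ x s +_) (sym (*-identityˡ (∑ xs (λ x → φ x s))))) rs ⟩
    E c (λ s → φ x s + 1ℚ * ∑ xs (λ x → φ x s)) rs
      ≡⟨ E-linear c 1ℚ (φ x) (λ s → ∑ xs (λ x → φ x s)) rs ⟩
    E c (φ x) rs + 1ℚ * E c (λ s → ∑ xs (λ x → φ x s)) rs
      ≡⟨ cong (E c (φ x) rs +_) (trans (*-identityˡ (E c (λ s → ∑ xs (λ x → φ x s)) rs)) (E-∑ c xs φ rs)) ⟩
    E c (φ x) rs + ∑ xs (λ x → E c (φ x) rs) ∎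

  E-linearˡ : ∀ c d k φ rs → E (λ r → c r + k * d r) φ rs ≡ E c φ rs + k * E d φ rs
  E-linearˡ c d k φ [] = solve 1 (λ k → con 0ℚ := con 0ℚ :+ k :* con 0ℚ) refl k
  E-linearˡ c d k φ (r ∷ rs) = trans (cong (λ z → (c r + k * d r) * φ rs - z) (E-linearˡ c d k (φ ∘ (r ∷_)) rs))
    (solve 6 (λ c d k f a b → (c :+ k :* d) :* f :- (a :+ k :* b) := c :* f :- a :+ k :* (d :* f :- b)) refl
      (c r) (d r) k (φ rs) (E c (φ ∘ (r ∷_)) rs) (E d (φ ∘ (r ∷_)) rs))

  -- The row r is used by c, used by d, or left to φ. Each form that passes over r contributes a
  -- sign: one in the second case, two in the third.
  E-E-∷ : ∀ c d φ r rs → E c (E d φ) (r ∷ rs) ≡ c r * E d φ rs - d r * E c φ rs + E c (E d (φ ∘ (r ∷_))) rs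
  E-E-∷ c d φ r rs = begin
    c r * E d φ rs - E c (λ s → d r * φ s - E d (φ ∘ (r ∷_)) s) rs
      ≡⟨ cong (λ z → c r * E d φ rs - z) (trans
           (E-cong {c = c} (λ _ → refl) (λ s → solve 2 (λ x y → x :- y := x :+ con (- 1ℚ) :* y) refl (d r * φ s) (E d (φ ∘ (r ∷_)) s)) rs)
           (trans (E-linear c (- 1ℚ) (λ s → d r * φ s) (E d (φ ∘ (r ∷_))) rs)
                  (cong (_+ - 1ℚ * E c (E d (φ ∘ (r ∷_))) rs) (E-scale c (d r) φ rs)))) ⟩
    c r * E d φ rs - (d r * E c φ rs + - 1ℚ * E c (E d (φ ∘ (r ∷_))) rs)
      ≡⟨ solve 3 (λ x y z → x :- (y :+ con (- 1ℚ) :* z) := x :- y :+ z) refl (c r * E d φ rs) (d r * E c φ rs) (E c (E d (φ ∘ (r ∷_))) rs) ⟩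
    c r * E d φ rs - d r * E c φ rs + E c (E d (φ ∘ (r ∷_))) rs ∎

  E-anticomm : ∀ c d φ rs → E c (E d φ) rs ≡ - E d (E c φ) rs
  E-anticomm c d φ [] = refl
  E-anticomm c d φ (r ∷ rs) = begin
    E c (E d φ) (r ∷ rs)
      ≡⟨ E-E-∷ c d φ r rs ⟩
    x - y + E c (E d φ′) rs
      ≡⟨ cong (x - y +_) (E-anticomm c d φ′ rs) ⟩
    x - y + - E d (E c φ′) rs
      ≡⟨ solve 3 (λ x y z → x :- y :+ :- z := :- (y :- x :+ z)) refl x y (E d (E c φ′) rs) ⟩
    - (y - x + E d (E c φ′) rs)
      ≡⟨ cong -_ (E-E-∷ d c φ r rs) ⟨
    - E d (E c φ) (r ∷ rs) ∎
    where
    φ′ = φ ∘ (r ∷_)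
    x = c r * E d φ rs
    y = d r * E c φ rs

  -- Two equal columns: the first two terms of `E-E-∷` cancel, and the recursion disposes of the
  -- third.
  E-E-self : ∀ c φ rs → E c (E c φ) rs ≡ 0ℚ
  E-E-self c φ [] = refl
  E-E-self c φ (r ∷ rs) = trans (E-E-∷ c c φ r rs) (trans (cong (x - x +_) (E-E-self c (φ ∘ (r ∷_)) rs))
    (solve 1 (λ x → x :- x :+ con 0ℚ := con 0ℚ) refl x))
    where x = c r * E c φ rs

  Chain : {I : Set} → (I → R → ℚ) → List I → List R → ℚ
  Chain c [] = ε
  Chain c (x ∷ xs) = E (c x) (Chain c xs)

  -- Induction step of `Chain-zero`: a zero row is either used by the current column, which
  -- contributes a zero entry, or passed on to later columns, which vanish on it.
  E-vanishing : ∀ {c : R → ℚ} {φ r} → c r ≡ 0ℚ → (∀ rs → φ (r ∷ rs) ≡ 0ℚ) → ∀ rs → E c φ (r ∷ rs) ≡ 0ℚ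
  E-vanishing {c} {φ} {r} cr≡0 φr≡0 rs = begin
    c r * φ rs - E c (φ ∘ (r ∷_)) rs    ≡⟨ cong₂ _-_ (cong (_* φ rs) cr≡0) (E-cong {c = c} (λ _ → refl) φr≡0 rs) ⟩
    0ℚ * φ rs - E c (λ _ → 0ℚ) rs       ≡⟨ cong₂ _-_ (*-zeroˡ (φ rs)) (E-zero c rs) ⟩
    0ℚ                                  ∎

  Chain-zero : ∀ {I : Set} {c : I → R → ℚ} {r rs xs} → All (λ x → c x r ≡ 0ℚ) xs → Chain c xs (r ∷ rs) ≡ 0ℚ
  Chain-zero [] = refl
  Chain-zero {c = c} {r} {rs} {x ∷ xs} (cx≡0 ∷ c≡0) = E-vanishing {c x} {Chain c xs} cx≡0 (λ _ → Chain-zero c≡0) rs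

  Chain-cong : ∀ {I : Set} {c d : I → R → ℚ} → (∀ i r → c i r ≡ d i r) → ∀ xs → Chain c xs ≗ Chain d xs
  Chain-cong c≡d [] _ = refl
  Chain-cong c≡d (x ∷ xs) = E-cong (c≡d x) (Chain-cong c≡d xs)

  Chain-scale : ∀ {I : Set} (k : I → ℚ) (c : I → R → ℚ) xs rs →
    Chain (λ i r → k i * c i r) xs rs ≡ ∏ xs k * Chain c xs rs
  Chain-scale k c [] rs = sym (*-identityˡ (ε rs))
  Chain-scale k c (x ∷ xs) rs = begin
    E (λ r → k x * c x r) (Chain (λ i r → k i * c i r) xs) rs
      -- The added zero term gives the scaled column the shape that `E-linearˡ` expects.
      ≡⟨ E-cong (λ r → solve 2 (λ k c → k :* c := con 0ℚ :* c :+ k :* c) refl (k x) (c x r)) (Chain-scale k c xs) rs ⟩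
    E (λ r → 0ℚ * c x r + k x * c x r) (λ s → ∏ xs k * Chain c xs s) rs
      ≡⟨ trans (E-scale _ (∏ xs k) (Chain c xs) rs) (cong (∏ xs k *_) (E-linearˡ (λ r → 0ℚ * c x r) (c x) (k x) (Chain c xs) rs)) ⟩
    ∏ xs k * (E (λ r → 0ℚ * c x r) (Chain c xs) rs + k x * E (c x) (Chain c xs) rs)
      ≡⟨ cong (λ z → ∏ xs k * (z + k x * E (c x) (Chain c xs) rs)) (E-null rs) ⟩
    ∏ xs k * (0ℚ + k x * E (c x) (Chain c xs) rs)
      ≡⟨ solve 3 (λ p k z → p :* (con 0ℚ :+ k :* z) := k :* p :* z) refl (∏ xs k) (k x) (E (c x) (Chain c xs) rs) ⟩
    k x * ∏ xs k * E (c x) (Chain c xs) rs ∎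
    where
    E-null : ∀ {φ} rs → E (λ r → 0ℚ * c x r) φ rs ≡ 0ℚ
    E-null [] = refl
    E-null {φ} (r ∷ rs) = cong₂ _-_ (trans (cong (_* φ rs) (*-zeroˡ (c x r))) (*-zeroˡ (φ rs))) (E-null rs)

  -- Column operations: subtract the column c from all the following ones.
  E-Chain-difference : ∀ {I : Set} (c : R → ℚ) (k : I → ℚ) (d d′ : I → R → ℚ) xs →
    (∀ x r → d x r ≡ c r + k x * d′ x r) → ∀ rs →
    E c (Chain d xs) rs ≡ ∏ xs k * E c (Chain d′ xs) rs
  E-Chain-difference c k d d′ [] eq rs = sym (*-identityˡ (E c ε rs))
  E-Chain-difference c k d d′ (x ∷ xs) eq rs = begin
    E c (E (d x) φ) rs
      ≡⟨ E-cong {c = c} (λ _ → refl) (E-cong (eq x) (λ _ → refl)) rs ⟩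
    E c (E (λ r → c r + k x * d′ x r) φ) rs
      ≡⟨ trans (E-cong {c = c} (λ _ → refl) (E-linearˡ c (d′ x) (k x) φ) rs) (E-linear c (k x) (E c φ) (E (d′ x) φ) rs) ⟩
    E c (E c φ) rs + k x * E c (E (d′ x) φ) rs
      -- The copy of c in the second column drops out. Then c is moved past `d′ x` to reach the
      -- induction hypothesis and moved back afterwards, so the two signs cancel.
      ≡⟨ cong₂ (λ y z → y + k x * z) (E-E-self c φ rs) (E-anticomm c (d′ x) φ rs) ⟩
    0ℚ + k x * - E (d′ x) (E c φ) rs
      ≡⟨ cong (λ z → 0ℚ + k x * - z) (trans (E-cong {c = d′ x} (λ _ → refl) (E-Chain-difference c k d d′ xs eq) rs)
           (E-scale (d′ x) (∏ xs k) (E c ψ) rs)) ⟩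
    0ℚ + k x * - (∏ xs k * E (d′ x) (E c ψ) rs)
      ≡⟨ cong (λ z → 0ℚ + k x * - (∏ xs k * z)) (E-anticomm (d′ x) c ψ rs) ⟩
    0ℚ + k x * - (∏ xs k * - E c (E (d′ x) ψ) rs)
      ≡⟨ solve 3 (λ k p z → con 0ℚ :+ k :* :- (p :* :- z) := k :* p :* z) refl (k x) (∏ xs k) (E c (E (d′ x) ψ) rs) ⟩
    k x * ∏ xs k * E c (E (d′ x) ψ) rs ∎
    where
    φ = Chain d xs
    ψ = Chain d′ xs

E-map : ∀ {R S : Set} (h : S → R) c φ rs → E c φ (map h rs) ≡ E (c ∘ h) (φ ∘ map h) rs
E-map h c φ [] = refl
E-map h c φ (r ∷ rs) = cong (λ z → c (h r) * φ (map h rs) - z) (E-map h c (φ ∘ (h r ∷_)) rs)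

Chain-map : ∀ {R S I : Set} (h : S → R) (c : I → R → ℚ) xs rs → Chain c xs (map h rs) ≡ Chain (λ i → c i ∘ h) xs rs
Chain-map h c [] [] = refl
Chain-map h c [] (_ ∷ _) = refl
Chain-map h c (x ∷ xs) rs = trans (E-map h (c x) (Chain c xs) rs) (E-cong (λ _ → refl) (Chain-map h c xs) rs)

module Symmetrization {R : Set} (c : ℕ → R → ℚ) (ρ : ℕ → ℕ → ℚ) (ρ-antisym : ∀ i j → ρ i j ≡ - ρ j i) where

  -- One summand of the symmetrization, as a recursion: `ys` lists the variables in permuted order
  -- and `rs` the parts they receive. The pair product covers all positions, as it does in the
  -- defining formula for n = l(μ).
  T : List R → List ℕ → ℚ
  T [] [] = 1ℚ
  T [] (_ ∷ _) = 0ℚ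
  T (_ ∷ _) [] = 0ℚ
  T (r ∷ rs) (y ∷ ys) = c y r * ∏ ys (ρ y) * T rs ys

  Π₂ : List ℕ → ℚ
  Π₂ [] = 1ℚ
  Π₂ (x ∷ xs) = ∏ xs (ρ x) * Π₂ xs

  ∏-insertions : ∀ x ys (f : ℕ → ℚ) → All (λ zs → ∏ zs f ≡ f x * ∏ ys f) (insertions x ys)
  ∏-insertions x [] f = refl ∷ []
  ∏-insertions x (y ∷ ys) f = refl ∷ map⁺ (All.map
    (λ eq → trans (cong (f y *_) eq) (solve 3 (λ a b c → a :* (b :* c) := b :* (a :* c)) refl (f y) (f x) (∏ ys f)))
    (∏-insertions x ys f))

  ∏-perms : ∀ xs (f : ℕ → ℚ) → All (λ ys → ∏ ys f ≡ ∏ xs f) (perms xs)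
  ∏-perms [] f = refl ∷ []
  ∏-perms (x ∷ xs) f = concat⁺ (map⁺ (All.map
    (λ {ys} eq → All.map (λ eq′ → trans eq′ (cong (f x *_) eq)) (∏-insertions x ys f))
    (∏-perms xs f)))

  -- Moving x behind y replaces ρ x y by ρ y x = - ρ x y. After the common factor is taken out, the
  -- positions of x therefore carry the alternating signs of a Laplace expansion along the column of
  -- x.
  ∑-insertions : ∀ x ys rs → ∑ (insertions x ys) (T rs) ≡ ∏ ys (ρ x) * E (c x) (λ s → T s ys) rs
  ∑-insertions x [] [] = refl
  ∑-insertions x [] (r ∷ []) = solve 1 (λ c → c :* con 1ℚ :* con 1ℚ :+ con 0ℚ := con 1ℚ :* (c :* con 1ℚ :- con 0ℚ)) refl (c x r)
  ∑-insertions x [] (r ∷ r′ ∷ rs) = begin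
    c x r * 1ℚ * 0ℚ + 0ℚ
      ≡⟨ solve 1 (λ c → c :* con 1ℚ :* con 0ℚ :+ con 0ℚ := con 1ℚ :* (c :* con 0ℚ :- con 0ℚ)) refl (c x r) ⟩
    1ℚ * (c x r * 0ℚ - 0ℚ)
      ≡⟨ cong (λ z → 1ℚ * (c x r * 0ℚ - z)) (E-zero (c x) (r′ ∷ rs)) ⟨
    1ℚ * (c x r * 0ℚ - E (c x) (λ _ → 0ℚ) (r′ ∷ rs)) ∎
  ∑-insertions x (y ∷ ys) [] = begin
    0ℚ + ∑ (map (y ∷_) (insertions x ys)) (T [])
      ≡⟨ cong (0ℚ +_) (trans (∑-map (y ∷_) (insertions x ys) (T [])) (∑-zero (All.universal (λ _ → refl) (insertions x ys)))) ⟩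
    0ℚ
      ≡⟨ *-zeroʳ (∏ (y ∷ ys) (ρ x)) ⟨
    ∏ (y ∷ ys) (ρ x) * 0ℚ ∎
  ∑-insertions x (y ∷ ys) (r ∷ rs) = begin
    c x r * (ρ x y * X) * T rs (y ∷ ys) + ∑ (map (y ∷_) (insertions x ys)) (T (r ∷ rs))
      ≡⟨ cong (c x r * (ρ x y * X) * T rs (y ∷ ys) +_) (trans (∑-map (y ∷_) (insertions x ys) (T (r ∷ rs))) (trans
           (∑-cong (All.map (λ {zs} eq → trans (cong (λ z → c y r * z * T rs zs) eq)
              (cong (λ z → c y r * (z * Y) * T rs zs) (ρ-antisym y x))) (∏-insertions x ys (ρ y))))
           (trans (∑-*ˡ (c y r * (- ρ x y * Y)) (insertions x ys) (T rs)) (cong (c y r * (- ρ x y * Y) *_) (∑-insertions x ys rs))))) ⟩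
    c x r * (ρ x y * X) * T rs (y ∷ ys) + c y r * (- ρ x y * Y) * (X * e)
      ≡⟨ solve 7 (λ cx cy r X Y t e → cx :* (r :* X) :* t :+ cy :* (:- r :* Y) :* (X :* e)
           := r :* X :* (cx :* t :- cy :* Y :* e)) refl (c x r) (c y r) (ρ x y) X Y (T rs (y ∷ ys)) e ⟩
    ρ x y * X * (c x r * T rs (y ∷ ys) - c y r * Y * e)
      ≡⟨ cong (λ z → ρ x y * X * (c x r * T rs (y ∷ ys) - z)) (E-scale (c x) (c y r * Y) (λ s → T s ys) rs) ⟨
    ρ x y * X * (c x r * T rs (y ∷ ys) - E (c x) (λ s → c y r * Y * T s ys) rs) ∎
    where
    X = ∏ ys (ρ x)
    Y = ∏ ys (ρ y)
    e = E (c x) (λ s → T s ys) rs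

  -- The factor that `∑-insertions` takes out is a product over all of `ys`, hence the same for
  -- every order of the remaining variables. What is left is the expansion of the determinant by its
  -- first column.
  ∑-perms : ∀ xs rs → ∑ (perms xs) (T rs) ≡ Π₂ xs * Chain c xs rs
  ∑-perms [] [] = refl
  ∑-perms [] (_ ∷ _) = refl
  ∑-perms (x ∷ xs) rs = begin
    ∑ (concatMap (insertions x) (perms xs)) (T rs)
      ≡⟨ ∑-concatMap (insertions x) (perms xs) (T rs) ⟩
    ∑ (perms xs) (λ ys → ∑ (insertions x ys) (T rs))
      ≡⟨ ∑-cong (All.map (λ {ys} eq → trans (∑-insertions x ys rs) (cong (_* E (c x) (λ s → T s ys) rs) eq)) (∏-perms xs (ρ x))) ⟩
    ∑ (perms xs) (λ ys → X * E (c x) (λ s → T s ys) rs)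
      ≡⟨ ∑-*ˡ X (perms xs) (λ ys → E (c x) (λ s → T s ys) rs) ⟩
    X * ∑ (perms xs) (λ ys → E (c x) (λ s → T s ys) rs)
      ≡⟨ cong (X *_) (E-∑ (c x) (perms xs) (λ ys s → T s ys) rs) ⟨
    X * E (c x) (λ s → ∑ (perms xs) (T s)) rs
      ≡⟨ cong (X *_) (trans (E-cong {c = c x} (λ _ → refl) (∑-perms xs) rs) (E-scale (c x) (Π₂ xs) (Chain c xs) rs)) ⟩
    X * (Π₂ xs * E (c x) (Chain c xs) rs)
      ≡⟨ *-assoc X (Π₂ xs) (E (c x) (Chain c xs) rs) ⟨
    X * Π₂ xs * E (c x) (Chain c xs) rs ∎
    where X = ∏ xs (ρ x)

  Triangular : List R → List ℕ → Set
  Triangular [] [] = ⊤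
  Triangular (r ∷ rs) (x ∷ xs) = All (λ y → c y r ≡ 0ℚ) xs × Triangular rs xs
  Triangular _ _ = ⊥

  -- Only the diagonal contributes to the determinant, and the diagonal times the pair product is
  -- the summand of the identity order.
  Chain-triangular : ∀ rs xs → Triangular rs xs → Π₂ xs * Chain c xs rs ≡ T rs xs
  Chain-triangular [] [] _ = refl
  Chain-triangular (r ∷ rs) (x ∷ xs) (c≡0 , tri) = begin
    ∏ xs (ρ x) * Π₂ xs * (c x r * Chain c xs rs - E (c x) (Chain c xs ∘ (r ∷_)) rs)
      ≡⟨ cong (λ z → ∏ xs (ρ x) * Π₂ xs * (c x r * Chain c xs rs - z))
           (trans (E-cong {c = c x} (λ _ → refl) (λ _ → Chain-zero c≡0) rs) (E-zero (c x) rs)) ⟩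
    ∏ xs (ρ x) * Π₂ xs * (c x r * Chain c xs rs - 0ℚ)
      ≡⟨ solve 4 (λ X p c z → X :* p :* (c :* z :- con 0ℚ) := c :* X :* (p :* z)) refl (∏ xs (ρ x)) (Π₂ xs) (c x r) (Chain c xs rs) ⟩
    c x r * ∏ xs (ρ x) * (Π₂ xs * Chain c xs rs)
      ≡⟨ cong (c x r * ∏ xs (ρ x) *_) (Chain-triangular rs xs tri) ⟩
    c x r * ∏ xs (ρ x) * T rs xs ∎

-- Polynomial degrees and divided differences

Poly-ext : ∀ n {f g} → (∀ t → f t ≡ g t) → Poly n f → Poly n g
Poly-ext zero f≡g f≡0 t = trans (sym (f≡g t)) (f≡0 t)
Poly-ext (suc n) f≡g (c , h , ph , f≡) = c , h , ph , λ t → trans (sym (f≡g t)) (f≡ t)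

Poly-zero : ∀ n {f} → (∀ t → f t ≡ 0ℚ) → Poly n f
Poly-zero zero f≡0 = f≡0
Poly-zero (suc n) f≡0 = 0ℚ , (λ _ → 0ℚ) , Poly-zero n (λ _ → refl) ,
  λ t → trans (f≡0 t) (solve 1 (λ t → con 0ℚ := con 0ℚ :+ t :* con 0ℚ) refl t)

Poly-const : ∀ n c → Poly (suc n) (λ _ → c)
Poly-const n c = c , (λ _ → 0ℚ) , Poly-zero n (λ _ → refl) , λ t → solve 2 (λ c t → c := c :+ t :* con 0ℚ) refl c t

Poly-mono : ∀ {m n f} → m ℕ.≤ n → Poly m f → Poly n f
Poly-mono {n = n} z≤n pf = Poly-zero n pf
Poly-mono (s≤s m≤n) (c , g , pg , f≡) = c , g , Poly-mono m≤n pg , f≡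

Poly-+ : ∀ n {f g} → Poly n f → Poly n g → Poly n (λ t → f t + g t)
Poly-+ zero f≡0 g≡0 t = cong₂ _+_ (f≡0 t) (g≡0 t)
Poly-+ (suc n) (c , h , ph , f≡) (c′ , h′ , ph′ , g≡) = c + c′ , (λ t → h t + h′ t) , Poly-+ n ph ph′ ,
  λ t → trans (cong₂ _+_ (f≡ t) (g≡ t))
    (solve 5 (λ c d t h k → c :+ t :* h :+ (d :+ t :* k) := c :+ d :+ t :* (h :+ k)) refl c c′ t (h t) (h′ t))

Poly-scale : ∀ n k {f} → Poly n f → Poly n (λ t → k * f t)
Poly-scale zero k f≡0 t = trans (cong (k *_) (f≡0 t)) (*-zeroʳ k)
Poly-scale (suc n) k (c , h , ph , f≡) = k * c , (λ t → k * h t) , Poly-scale n k ph ,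
  λ t → trans (cong (k *_) (f≡ t)) (solve 4 (λ k c t h → k :* (c :+ t :* h) := k :* c :+ t :* (k :* h)) refl k c t (h t))

Poly-t* : ∀ n {f} → Poly n f → Poly (suc n) (λ t → t * f t)
Poly-t* n {f} pf = 0ℚ , f , pf , λ t → sym (+-identityˡ (t * f t))

Poly-* : ∀ m n {f g} → Poly (suc m) f → Poly (suc n) g → Poly (suc (m ℕ.+ n)) (λ t → f t * g t)
Poly-* zero n {g = g} (c , h , h≡0 , f≡) pg = Poly-ext (suc n)
  (λ t → cong (_* g t) (sym (trans (f≡ t) (trans (cong (λ z → c + t * z) (h≡0 t)) (solve 2 (λ c t → c :+ t :* con 0ℚ := c) refl c t)))))
  (Poly-scale (suc n) c pg)
Poly-* (suc m) n {g = g} (c , h , ph , f≡) pg = Poly-ext (suc (suc (m ℕ.+ n)))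
  (λ t → sym (trans (cong (_* g t) (f≡ t)) (solve 4 (λ c t h g → (c :+ t :* h) :* g := c :* g :+ t :* (h :* g)) refl c t (h t) (g t))))
  (Poly-+ (suc (suc (m ℕ.+ n)))
    (Poly-scale (suc (suc (m ℕ.+ n))) c (Poly-mono (s≤s (ℕ.m≤n⇒m≤1+n (ℕ.m≤n+m n m))) pg))
    (Poly-t* (suc (m ℕ.+ n)) (Poly-* m n ph pg)))

Linear : (ℚ → ℚ) → Set
Linear = Poly 2

Poly-linear* : ∀ n {x f} → Linear x → Poly n f → Poly (suc n) (λ t → x t * f t)
Poly-linear* zero {x} lx f≡0 = Poly-zero 1 (λ t → trans (cong (x t *_) (f≡0 t)) (*-zeroʳ (x t)))
Poly-linear* (suc n) lx pf = Poly-* 1 n lx pf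

Poly-∏* : ∀ {A : Set} (xs : List A) n {f : ℚ → A → ℚ} {g} → All (λ x → Linear (λ t → f t x)) xs → Poly n g →
  Poly (length xs ℕ.+ n) (λ t → ∏ xs (f t) * g t)
Poly-∏* [] n {g = g} [] pg = Poly-ext n (λ t → sym (*-identityˡ (g t))) pg
Poly-∏* (x ∷ xs) n {f} {g} (lx ∷ lxs) pg = Poly-ext (suc (length xs ℕ.+ n))
  (λ t → sym (*-assoc (f t x) (∏ xs (f t)) (g t))) (Poly-linear* (length xs ℕ.+ n) lx (Poly-∏* xs n lxs pg))

-- Degree at most d - e; in particular f vanishes when d < e.
Deg : ℕ → ℕ → (ℚ → ℚ) → Set
Deg e d f = (∀ t → f t ≡ 0ℚ) ⊎ ∃ λ k → k ℕ.+ e ℕ.≤ d × Poly (suc k) f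

-- The truncated difference is 0 exactly when e > d, and then f is the zero function.
Poly⇒Deg : ∀ e d {f} → Poly (suc d ∸ e) f → Deg e d f
Poly⇒Deg e d {f} pf with suc d ∸ e in eq
... | zero = inj₁ pf
... | suc k = inj₂ (k , ℕ.s≤s⁻¹ (ℕ.≤-reflexive (trans (cong (ℕ._+ e) (sym eq)) (ℕ.m∸n+n≡m e≤1+d))) , pf)
  where
  e≤1+d : e ℕ.≤ suc d
  e≤1+d = ℕ.<⇒≤ (ℕ.m∸n≢0⇒n<m λ eq′ → contradiction (trans (sym eq) eq′) λ ())

Deg-+ : ∀ {e d f g} → Deg e d f → Deg e d g → Deg e d (λ t → f t + g t)
Deg-+ {f = f} {g} (inj₁ f≡0) (inj₁ g≡0) = inj₁ λ t → cong₂ _+_ (f≡0 t) (g≡0 t)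
Deg-+ {f = f} {g} (inj₁ f≡0) (inj₂ (k , k≤ , pg)) = inj₂ (k , k≤ ,
  Poly-ext (suc k) (λ t → sym (trans (cong (_+ g t) (f≡0 t)) (+-identityˡ (g t)))) pg)
Deg-+ {f = f} {g} (inj₂ (k , k≤ , pf)) (inj₁ g≡0) = inj₂ (k , k≤ ,
  Poly-ext (suc k) (λ t → sym (trans (cong (f t +_) (g≡0 t)) (+-identityʳ (f t)))) pf)
Deg-+ {e} {d} (inj₂ (k , k≤ , pf)) (inj₂ (l , l≤ , pg)) = inj₂ (k ℕ.⊔ l , m≤ ,
  Poly-+ (suc (k ℕ.⊔ l)) (Poly-mono (s≤s (ℕ.m≤m⊔n k l)) pf) (Poly-mono (s≤s (ℕ.m≤n⊔m k l)) pg))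
  where
  m≤ : (k ℕ.⊔ l) ℕ.+ e ℕ.≤ d
  m≤ = subst (ℕ._≤ d) (sym (ℕ.+-distribʳ-⊔ e k l)) (ℕ.⊔-lub k≤ l≤)

Deg-scale : ∀ {e d f} c → Deg e d f → Deg e d (λ t → c * f t)
Deg-scale c (inj₁ f≡0) = inj₁ λ t → trans (cong (c *_) (f≡0 t)) (*-zeroʳ c)
Deg-scale c (inj₂ (k , k≤ , pf)) = inj₂ (k , k≤ , Poly-scale (suc k) c pf)

Deg-* : ∀ {e e′ d d′ f g} → Deg e d f → Deg e′ d′ g → Deg (e ℕ.+ e′) (d ℕ.+ d′) (λ t → f t * g t)
Deg-* {g = g} (inj₁ f≡0) _ = inj₁ λ t → trans (cong (_* g t) (f≡0 t)) (*-zeroˡ (g t))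
Deg-* {f = f} (inj₂ _) (inj₁ g≡0) = inj₁ λ t → trans (cong (f t *_) (g≡0 t)) (*-zeroʳ (f t))
Deg-* {e} {e′} {d} {d′} (inj₂ (k , k≤ , pf)) (inj₂ (l , l≤ , pg)) = inj₂ (k ℕ.+ l ,
  subst (ℕ._≤ d ℕ.+ d′) (interchange k e l e′) (ℕ.+-mono-≤ k≤ l≤) , Poly-* k l pf pg)

Deg-ext : ∀ {e d f g} → (∀ t → f t ≡ g t) → Deg e d f → Deg e d g
Deg-ext f≡g (inj₁ f≡0) = inj₁ (Poly-ext 0 f≡g f≡0)
Deg-ext f≡g (inj₂ (k , k≤ , pf)) = inj₂ (k , k≤ , Poly-ext (suc k) f≡g pf)

-- Each term spends one row r on c, with degree at most r - j, and hands the other rows to φ, so the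
-- bounds add up. The parameter `d` collects the rows that the recursion has passed over.
E-Deg : ∀ {c : ℚ → ℕ → ℚ} {φ : ℚ → List ℕ → ℚ} {j e} d → (∀ r → Deg j r (λ t → c t r)) →
  (∀ rs → Deg e (d ℕ.+ sizeℕ rs) (λ t → φ t rs)) → ∀ rs → Deg (j ℕ.+ e) (d ℕ.+ sizeℕ rs) (λ t → E (c t) (φ t) rs)
E-Deg d dc dφ [] = inj₁ λ _ → refl
E-Deg {c} {φ} {j} {e} d dc dφ (r ∷ rs) = Deg-ext
  (λ t → solve 2 (λ x y → x :+ con (- 1ℚ) :* y := x :- y) refl (c t r * φ t rs) (E (c t) (φ t ∘ (r ∷_)) rs))
  (Deg-+
    (subst (λ z → Deg (j ℕ.+ e) z (λ t → c t r * φ t rs)) (x∙yz≈y∙xz r d (sizeℕ rs)) (Deg-* (dc r) (dφ rs)))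
    (Deg-scale (- 1ℚ) (subst (λ z → Deg (j ℕ.+ e) z (λ t → E (c t) (φ t ∘ (r ∷_)) rs)) (ℕ.+-assoc d r (sizeℕ rs))
      (E-Deg (d ℕ.+ r) dc (λ s → subst (λ z → Deg e z (λ t → φ t (r ∷ s))) (sym (ℕ.+-assoc d r (sizeℕ s))) (dφ (r ∷ s))) rs))))

eval : List ℚ → ℚ → ℚ
eval [] z = 0ℚ
eval (c ∷ p) z = c + z * eval p z

-- Synthetic division: `horner y p` represents (z p(z) - y p(y)) / (z - y). Hence `quot y p` is the
-- divided difference (p(z) - p(y)) / (z - y), computed without dividing.
horner : ℚ → List ℚ → List ℚ
horner y [] = []
horner y (c ∷ p) = (c + y * eval p y) ∷ horner y p

quot : ℚ → List ℚ → List ℚ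
quot y [] = []
quot y (c ∷ p) = horner y p

eval-horner : ∀ y p z → z * eval p z ≡ y * eval p y + (z - y) * eval (horner y p) z
eval-horner y [] z = solve 2 (λ z y → z :* con 0ℚ := y :* con 0ℚ :+ (z :- y) :* con 0ℚ) refl z y
eval-horner y (c ∷ p) z = trans (cong (λ u → z * (c + u)) (eval-horner y p z))
  (solve 5 (λ c y z p h → z :* (c :+ (y :* p :+ (z :- y) :* h)) := y :* (c :+ y :* p) :+ (z :- y) :* (c :+ y :* p :+ z :* h))
    refl c y z (eval p y) (eval (horner y p) z))

eval-quot : ∀ y p z → eval p z ≡ eval p y + (z - y) * eval (quot y p) z
eval-quot y [] z = solve 2 (λ z y → con 0ℚ := con 0ℚ :+ (z :- y) :* con 0ℚ) refl z y
eval-quot y (c ∷ p) z = trans (cong (c +_) (eval-horner y p z)) (sym (+-assoc c (y * eval p y) ((z - y) * eval (horner y p) z)))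

-- Polynomials in z and t of total degree < n, as lists of the coefficients of
-- the powers of z, which are functions of t.
Coeffs : ℕ → (ℚ → List ℚ) → Set
Coeffs zero p = ∀ t → p t ≡ []
Coeffs (suc n) p = ∃₂ λ c q → Poly (suc n) c × Coeffs n q × (∀ t → p t ≡ c t ∷ q t)

Coeffs-const : ∀ p → Coeffs (length p) (λ _ → p)
Coeffs-const [] _ = refl
Coeffs-const (c ∷ p) = (λ _ → c) , (λ _ → p) , Poly-const (length p) c , Coeffs-const p , λ _ → refl

Poly-eval : ∀ n {p x} → Linear x → Coeffs n p → Poly n (λ t → eval (p t) (x t))
Poly-eval zero {p} {x} lx p≡ t = cong (λ q → eval q (x t)) (p≡ t)
Poly-eval (suc n) {p} {x} lx (c , q , pc , cq , p≡) = Poly-ext (suc n) (λ t → cong (λ q → eval q (x t)) (sym (p≡ t)))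
  (Poly-+ (suc n) pc (Poly-linear* n lx (Poly-eval n lx cq)))

Coeffs-horner : ∀ n {p y} → Linear y → Coeffs n p → Coeffs n (λ t → horner (y t) (p t))
Coeffs-horner zero {y = y} ly p≡ t = cong (horner (y t)) (p≡ t)
Coeffs-horner (suc n) {y = y} ly (c , q , pc , cq , p≡) = _ , _ ,
  Poly-+ (suc n) pc (Poly-linear* n ly (Poly-eval n ly cq)) , Coeffs-horner n ly cq , λ t → cong (horner (y t)) (p≡ t)

-- Total degree in z and t is the right measure here: a divided difference at a point y linear in t
-- lowers it by one, although its coefficients now depend on t.
Coeffs-quot : ∀ n {p y} → Linear y → Coeffs n p → Coeffs (ℕ.pred n) (λ t → quot (y t) (p t))
Coeffs-quot zero {y = y} ly p≡ t = cong (quot (y t)) (p≡ t)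
Coeffs-quot (suc n) {p} {y} ly (c , q , pc , cq , p≡) = Coeffs-ext n (λ t → cong (quot (y t)) (sym (p≡ t))) (Coeffs-horner n ly cq)
  where
  Coeffs-ext : ∀ n {p q} → (∀ t → p t ≡ q t) → Coeffs n p → Coeffs n q
  Coeffs-ext zero p≡q p≡ t = trans (sym (p≡q t)) (p≡ t)
  Coeffs-ext (suc n) p≡q (c , r , pc , cr , p≡) = c , r , pc , cr , λ t → trans (sym (p≡q t)) (p≡ t)

-- n(n-1)/2, the number of pairs i < j.
tri : ℕ → ℕ
tri zero = 0
tri (suc n) = n ℕ.+ tri n

-- The determinant of Newton divided differences.
newton : {R : Set} → (ℕ → ℚ) → (R → List ℚ) → List ℕ → List R → ℚ
newton x p [] = ε
newton x p (i ∷ is) = E (λ r → eval (p r) (x i)) (newton x (quot (x i) ∘ p) is)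

vandermonde : (ℕ → ℚ) → List ℕ → ℚ
vandermonde x [] = 1ℚ
vandermonde x (i ∷ is) = ∏ is (λ j → x j - x i) * vandermonde x is

-- Since p(x_j) = p(x_i) + (x_j - x_i) q(x_j) with q the quotient at x_i, subtracting column i from
-- the later ones releases the factors x_j - x_i and leaves the same problem for the quotients.
Chain-newton : ∀ {R : Set} x (p : R → List ℚ) is rs →
  Chain (λ i r → eval (p r) (x i)) is rs ≡ vandermonde x is * newton x p is rs
Chain-newton x p [] rs = sym (*-identityˡ (ε rs))
Chain-newton x p (i ∷ is) rs = begin
  E c (Chain (λ j r → eval (p r) (x j)) is) rs
    ≡⟨ E-Chain-difference c (λ j → x j - x i) (λ j r → eval (p r) (x j)) (λ j r → eval (quot (x i) (p r)) (x j)) is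
         (λ j r → eval-quot (x i) (p r) (x j)) rs ⟩
  ∏ is (λ j → x j - x i) * E c (Chain (λ j r → eval (quot (x i) (p r)) (x j)) is) rs
    ≡⟨ cong (∏ is (λ j → x j - x i) *_) (trans (E-cong {c = c} (λ _ → refl) (Chain-newton x (quot (x i) ∘ p) is) rs)
         (E-scale c (vandermonde x is) (newton x (quot (x i) ∘ p) is) rs)) ⟩
  ∏ is (λ j → x j - x i) * (vandermonde x is * E c (newton x (quot (x i) ∘ p) is) rs)
    ≡⟨ *-assoc (∏ is (λ j → x j - x i)) (vandermonde x is) (E c (newton x (quot (x i) ∘ p) is) rs) ⟨
  ∏ is (λ j → x j - x i) * vandermonde x is * E c (newton x (quot (x i) ∘ p) is) rs ∎
  where c = λ r → eval (p r) (x i)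

-- Here j counts the quotients already taken. The remaining columns lower the degree by j, j + 1,
-- ..., and the first index of `Deg` is the sum of these numbers.
newton-Deg : ∀ (x : ℚ → ℕ → ℚ) → (∀ i → Linear (λ t → x t i)) → ∀ is j (p : ℚ → ℕ → List ℚ) →
  (∀ r → Coeffs (suc r ∸ j) (λ t → p t r)) → ∀ rs →
  Deg (length is ℕ.* j ℕ.+ tri (length is)) (sizeℕ rs) (λ t → newton (x t) (p t) is rs)
newton-Deg x lx [] j p cp [] = inj₂ (0 , z≤n , Poly-const 0 1ℚ)
newton-Deg x lx [] j p cp (r ∷ rs) = inj₁ λ _ → refl
newton-Deg x lx (i ∷ is) j p cp rs = subst (λ e → Deg e (sizeℕ rs) (λ t → newton (x t) (p t) (i ∷ is) rs))
  (exponent (length is) j (tri (length is)))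
  (E-Deg 0 (λ r → Poly⇒Deg j r (Poly-eval (suc r ∸ j) (lx i) (cp r)))
    (newton-Deg x lx is (suc j) (λ t → quot (x t i) ∘ p t)
      (λ r → subst (λ n → Coeffs n (λ t → quot (x t i) (p t r))) (ℕ.pred[m∸n]≡m∸[1+n] (suc r) j) (Coeffs-quot (suc r ∸ j) (lx i) (cp r)))) rs)
  where
  exponent : ∀ m j w → j ℕ.+ (m ℕ.* suc j ℕ.+ w) ≡ suc m ℕ.* j ℕ.+ (m ℕ.+ w)
  exponent = solve-∀

-- Falling factorials as coefficient lists

timesRoot : ℚ → ℚ → List ℚ → List ℚ
timesRoot a k [] = k ∷ []
timesRoot a k (c ∷ p) = (k - a * c) ∷ timesRoot a c p

-- The argument `k` is a carry, the coefficient of p one power lower. With k = 0 this is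
-- multiplication by z - a.
eval-timesRoot : ∀ a k p z → eval (timesRoot a k p) z ≡ k + (z - a) * eval p z
eval-timesRoot a k [] z = solve 3 (λ k z a → k :+ z :* con 0ℚ := k :+ (z :- a) :* con 0ℚ) refl k z a
eval-timesRoot a k (c ∷ p) z = trans (cong (λ u → k - a * c + z * u) (eval-timesRoot a c p z))
  (solve 5 (λ a k c z e → k :- a :* c :+ z :* (c :+ (z :- a) :* e) := k :+ (z :- a) :* (c :+ z :* e)) refl a k c z (eval p z))

length-timesRoot : ∀ a k p → length (timesRoot a k p) ≡ suc (length p)
length-timesRoot a k [] = refl
length-timesRoot a k (c ∷ p) = cong suc (length-timesRoot a c p)

fromRoots : List ℕ → List ℚ
fromRoots [] = 1ℚ ∷ []
fromRoots (a ∷ as) = timesRoot (ℕ→ℚ a) 0ℚ (fromRoots as)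

eval-fromRoots : ∀ as z → eval (fromRoots as) z ≡ ∏ as (λ a → z - ℕ→ℚ a)
eval-fromRoots [] z = solve 1 (λ z → con 1ℚ :+ z :* con 0ℚ := con 1ℚ) refl z
eval-fromRoots (a ∷ as) z = trans (eval-timesRoot (ℕ→ℚ a) 0ℚ (fromRoots as) z)
  (trans (+-identityˡ _) (cong ((z - ℕ→ℚ a) *_) (eval-fromRoots as z)))

length-fromRoots : ∀ as → length (fromRoots as) ≡ suc (length as)
length-fromRoots [] = refl
length-fromRoots (a ∷ as) = trans (length-timesRoot (ℕ→ℚ a) 0ℚ (fromRoots as)) (cong suc (length-fromRoots as))

-- The polynomial (z - 1)...(z - r), which is the falling factorial with r + 1 factors after its
-- factor z is split off.
fallCoeffs : ℕ → List ℚ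
fallCoeffs r = fromRoots (applyUpTo suc r)

fall-suc : ∀ x r → fall x (suc r) ≡ x * eval (fallCoeffs r) x
fall-suc x r = cong₂ _*_ (solve 1 (λ x → x :- con 0ℚ := x) refl x) (sym (eval-fromRoots (applyUpTo suc r) x))

Coeffs-fallCoeffs : ∀ r → Coeffs (suc r) (λ _ → fallCoeffs r)
Coeffs-fallCoeffs r = subst (λ n → Coeffs n (λ _ → fallCoeffs r))
  (trans (length-fromRoots (applyUpTo suc r)) (cong suc (length-applyUpTo suc r))) (Coeffs-const (fallCoeffs r))

-- Strict partitions and permutations

∏-upTo-suc : ∀ n f → ∏ (upTo (suc n)) f ≡ f 0 * ∏ (upTo n) (f ∘ suc)
∏-upTo-suc n f = cong (f 0 *_) (trans (cong (λ is → ∏ is f) (sym (map-upTo suc n))) (∏-map suc (upTo n) f))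

∏-part : ∀ ys f → ∏ (upTo (length ys)) (f ∘ part ys) ≡ ∏ ys f
∏-part [] f = refl
∏-part (y ∷ ys) f = trans (∏-upTo-suc (length ys) (f ∘ part (y ∷ ys))) (cong (f y *_) (∏-part ys f))

All-part : ∀ {P : ℕ → Set} {xs i} → All P xs → i < length xs → P (part xs i)
All-part {i = zero} (px ∷ _) _ = px
All-part {i = suc i} (_ ∷ pxs) (s≤s i<) = All-part pxs i<

AllPairs-part : ∀ {R : ℕ → ℕ → Set} {xs i j} → AllPairs R xs → i < j → j < length xs → R (part xs i) (part xs j)
AllPairs-part {i = zero} {suc j} (rx ∷ _) _ (s≤s j<) = All-part rx j<
AllPairs-part {i = suc i} {suc j} (_ ∷ rxs) (s≤s i<j) (s≤s j<) = AllPairs-part rxs i<j j<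

part-> : ∀ xs {i} → 0 < part xs i → i < length xs
part-> (x ∷ xs) {zero} _ = s≤s z≤n
part-> (x ∷ xs) {suc i} 0<p = s≤s (part-> xs 0<p)

Decreasing : List ℕ → Set
Decreasing = AllPairs _>_

IsStrict⇒Decreasing : ∀ {xs} → IsStrict xs → Decreasing xs
IsStrict⇒Decreasing = Linked⇒AllPairs (λ i>j j>k → ℕ.<-trans j>k i>j) ∘ proj₂

part-antitone : ∀ {xs i j} → Decreasing xs → i ℕ.≤ j → part xs j ℕ.≤ part xs i
part-antitone [] z≤n = z≤n
part-antitone [] (s≤s _) = z≤n
part-antitone {_} {zero} {zero} (x> ∷ xs>) z≤n = ℕ.≤-refl
part-antitone {x ∷ xs} {zero} {suc j} (x> ∷ xs>) z≤n = bound x> j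
  where
  bound : ∀ {xs} → All (x >_) xs → ∀ j → part xs j ℕ.≤ x
  bound [] j = z≤n
  bound (x>y ∷ _) zero = ℕ.<⇒≤ x>y
  bound (_ ∷ x>) (suc j) = bound x> j
part-antitone {x ∷ xs} (x> ∷ xs>) (s≤s i≤j) = part-antitone xs> i≤j

part-upTo : ∀ {n i} → i < n → part (upTo n) i ≡ i
part-upTo = part-applyUpTo (λ i → i)
  where
  part-applyUpTo : ∀ f {n i} → i < n → part (applyUpTo f n) i ≡ f i
  part-applyUpTo f {suc n} {zero} _ = refl
  part-applyUpTo f {suc n} {suc i} (s≤s i<n) = part-applyUpTo (f ∘ suc) i<n

insertions-↭ : ∀ x ys → All (_↭ (x ∷ ys)) (insertions x ys)
insertions-↭ x [] = refl ∷ []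
insertions-↭ x (y ∷ ys) = refl ∷ map⁺ (All.map (λ p → ↭-trans (prep y p) (swap y x refl)) (insertions-↭ x ys))

perms-↭ : ∀ xs → All (_↭ xs) (perms xs)
perms-↭ [] = refl ∷ []
perms-↭ (x ∷ xs) = concat⁺ (map⁺ (All.map (λ {ys} p → All.map (λ q → ↭-trans q (prep x p)) (insertions-↭ x ys)) (perms-↭ xs)))

-- Otherwise the i + 1 distinct values at positions 0, ..., i would all lie below i, against the
-- pigeonhole principle.
permutation-exceeds : ∀ {n ω i} → ω ↭ upTo n → i < n → ∃ λ j → j ℕ.≤ i × i ℕ.≤ part ω j
permutation-exceeds {n} {ω} {i} p i<n with any? (λ (j : Fin (suc i)) → i ℕ.≤? part ω (toℕ j))
... | yes (j , i≤) = toℕ j , ℕ.s≤s⁻¹ (toℕ<n j) , i≤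
... | no ∄ = contradiction same (AllPairs-part ω! a<b (ℕ.≤-trans (toℕ<n b) (subst (suc i ℕ.≤_) (sym ∣ω∣) i<n)))
  where
  ω! : Unique ω
  ω! = Unique-resp-↭ (↭⇒↭ₛ (↭-sym p)) (upTo⁺ n)
  ∣ω∣ : length ω ≡ n
  ∣ω∣ = trans (↭-length p) (length-upTo n)
  below : ∀ (j : Fin (suc i)) → part ω (toℕ j) < i
  below j = ℕ.≰⇒> (λ i≤ → ∄ (j , i≤))
  collision = pigeonhole (ℕ.n<1+n i) (λ j → fromℕ< (below j))
  a = proj₁ collision
  b = proj₁ (proj₂ collision)
  a<b = proj₁ (proj₂ (proj₂ collision))
  same : part ω (toℕ a) ≡ part ω (toℕ b)
  same = trans (sym (toℕ-fromℕ< (below a))) (trans (cong toℕ (proj₂ (proj₂ (proj₂ collision)))) (toℕ-fromℕ< (below b)))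

-- The defining formula at λ

fall-step : ∀ a k → fall (ℕ→ℚ (suc a)) (suc k) ≡ ℕ→ℚ (suc a) * fall (ℕ→ℚ a) k
fall-step a k = trans (∏-upTo-suc k (λ i → ℕ→ℚ (suc a) - ℕ→ℚ i)) (cong₂ _*_
  (solve 1 (λ x → x :- con 0ℚ := x) refl (ℕ→ℚ (suc a)))
  (∏-cong (All.universal (λ i → trans (cong₂ _-_ (ℕ→ℚ-+ 1 a) (ℕ→ℚ-+ 1 i))
    (solve 2 (λ x y → con 1ℚ :+ x :- (con 1ℚ :+ y) := x :- y) refl (ℕ→ℚ a) (ℕ→ℚ i))) (upTo k))))

fall-zero : ∀ {a k} → a < k → fall (ℕ→ℚ a) k ≡ 0ℚ
fall-zero {zero} {suc k} _ = *-zeroˡ (prodℚ (map (λ i → ℕ→ℚ 0 - ℕ→ℚ i) (applyUpTo suc k)))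
fall-zero {suc a} {suc k} (s≤s a<k) = trans (fall-step a k) (trans (cong (ℕ→ℚ (suc a) *_) (fall-zero a<k)) (*-zeroʳ (ℕ→ℚ (suc a))))

fall-self : ∀ a → fall (ℕ→ℚ a) a ≡ ℕ→ℚ (a !)
fall-self zero = refl
fall-self (suc a) = trans (fall-step a a) (trans (cong (ℕ→ℚ (suc a) *_) (fall-self a)) (sym (ℕ→ℚ-* (suc a) (a !))))

formula-≮ : ∀ μ n x → ¬ n < length μ → formula μ n x ≡ (1ℚ ÷' ℕ→ℚ ((n ∸ length μ) !)) * ∑ (Sym n) (summand μ n x)
formula-≮ μ n x n≮l with n ℕ.<? length μ
... | yes n<l = contradiction n<l n≮l
... | no _ = refl

module Summand (x : ℕ → ℚ) where

  ρ : ℕ → ℕ → ℚ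
  ρ i j = (x i + x j) ÷' (x i - x j)

  ρ-antisym : ∀ i j → ρ i j ≡ - ρ j i
  ρ-antisym i j = trans (cong₂ _÷'_ (+-comm (x i) (x j)) (solve 2 (λ a b → a :- b := :- (b :- a)) refl (x i) (x j)))
    (÷'-neg (x j + x i) (x j - x i))

  column : ℕ → ℕ → ℚ
  column i r = fall (x i) r

  open Symmetrization column ρ ρ-antisym public

  -- Passes from the pair product over positions, as in `summand`, to the recursion on the list of
  -- variables.
  Π₂-indexed : ∀ ys → ∏ (upTo (length ys)) (λ i → ∏ (drop (suc i) (upTo (length ys))) (λ j → ρ (part ys i) (part ys j))) ≡ Π₂ ys
  Π₂-indexed [] = refl
  Π₂-indexed (y ∷ ys) = begin
    ∏ (upTo (suc n)) (λ i → ∏ (drop (suc i) (upTo (suc n))) (λ j → ρ (part (y ∷ ys) i) (part (y ∷ ys) j)))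
      ≡⟨ ∏-upTo-suc n (λ i → ∏ (drop (suc i) (upTo (suc n))) (λ j → ρ (part (y ∷ ys) i) (part (y ∷ ys) j))) ⟩
    ∏ (applyUpTo suc n) (λ j → ρ y (part (y ∷ ys) j)) *
      ∏ (upTo n) (λ i → ∏ (drop (suc i) (applyUpTo suc n)) (λ j → ρ (part ys i) (part (y ∷ ys) j)))
      ≡⟨ cong₂ _*_
           (trans (cong (λ js → ∏ js (λ j → ρ y (part (y ∷ ys) j))) (sym (map-upTo suc n)))
             (trans (∏-map suc (upTo n) (λ j → ρ y (part (y ∷ ys) j))) (∏-part ys (ρ y))))
           (trans (∏-cong (All.universal (λ i → trans
             (cong (λ js → ∏ js (λ j → ρ (part ys i) (part (y ∷ ys) j)))
               (trans (cong (drop (suc i)) (sym (map-upTo suc n))) (drop-map (suc i) (upTo n))))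
             (∏-map suc (drop (suc i) (upTo n)) (λ j → ρ (part ys i) (part (y ∷ ys) j)))) (upTo n)))
             (Π₂-indexed ys)) ⟩
    ∏ ys (ρ y) * Π₂ ys ∎
    where n = length ys

  T-indexed : ∀ rs ys → length ys ≡ length rs →
    T rs ys ≡ ∏ (upTo (length rs)) (λ i → fall (x (part ys i)) (part rs i)) * Π₂ ys
  T-indexed [] [] _ = refl
  T-indexed (r ∷ rs) (y ∷ ys) eq = begin
    fall (x y) r * ∏ ys (ρ y) * T rs ys
      ≡⟨ cong (fall (x y) r * ∏ ys (ρ y) *_) (T-indexed rs ys (ℕ.suc-injective eq)) ⟩
    fall (x y) r * ∏ ys (ρ y) * (A * Π₂ ys)
      ≡⟨ solve 4 (λ f p a q → f :* p :* (a :* q) := f :* a :* (p :* q)) refl (fall (x y) r) (∏ ys (ρ y)) A (Π₂ ys) ⟩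
    fall (x y) r * A * (∏ ys (ρ y) * Π₂ ys)
      ≡⟨ cong (_* (∏ ys (ρ y) * Π₂ ys)) (∏-upTo-suc (length rs) (λ i → fall (x (part (y ∷ ys) i)) (part (r ∷ rs) i))) ⟨
    ∏ (upTo (suc (length rs))) (λ i → fall (x (part (y ∷ ys) i)) (part (r ∷ rs) i)) * (∏ ys (ρ y) * Π₂ ys) ∎
    where A = ∏ (upTo (length rs)) (λ i → fall (x (part ys i)) (part rs i))

  summand-T : ∀ μ ω → length ω ≡ length μ → summand μ (length μ) x ω ≡ T μ ω
  summand-T μ ω eq = trans
    (cong (∏ (upTo (length μ)) (λ i → fall (x (part ω i)) (part μ i)) *_)
      (trans (cong (λ n → ∏ (upTo n) (λ i → ∏ (drop (suc i) (upTo n)) (λ j → ρ (part ω i) (part ω j)))) (sym eq)) (Π₂-indexed ω)))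
    (sym (T-indexed μ ω eq))

  -- For n = l(μ) the prefactor is 1/0! = 1 and every summand is a `T`, so the determinant identity
  -- `∑-perms` applies.
  formula-Chain : ∀ μ → formula μ (length μ) x ≡ Π₂ (upTo (length μ)) * Chain column (upTo (length μ)) μ
  formula-Chain μ = begin
    formula μ n x
      ≡⟨ formula-≮ μ n x (ℕ.n≮n n) ⟩
    (1ℚ ÷' ℕ→ℚ ((n ∸ n) !)) * S
      ≡⟨ cong (_* S) (trans (cong (λ k → 1ℚ ÷' ℕ→ℚ (k !)) (ℕ.n∸n≡0 n)) 1÷1) ⟩
    1ℚ * S
      ≡⟨ *-identityˡ S ⟩
    S
      ≡⟨ ∑-cong (All.map (λ {ω} p → summand-T μ ω (trans (↭-length p) (length-upTo n))) (perms-↭ (upTo n))) ⟩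
    ∑ (Sym n) (T μ)
      ≡⟨ ∑-perms (upTo n) μ ⟩
    Π₂ (upTo n) * Chain column (upTo n) μ ∎
    where
    n = length μ
    S = ∑ (Sym n) (summand μ n x)
    1÷1 : 1ℚ ÷' ℕ→ℚ 1 ≡ 1ℚ
    1÷1 = refl

  Π₊ : List ℕ → ℚ
  Π₊ [] = 1ℚ
  Π₊ (i ∷ is) = ∏ is (λ j → - 1ℚ * (x i + x j)) * Π₊ is

  -- The Vandermonde product clears every denominator. Its factors are x_j - x_i and the
  -- denominators x_i - x_j, whence the sign in each factor of `Π₊`.
  Π₂-vandermonde : ∀ {is} → AllPairs (λ i j → x i ≢ x j) is → Π₂ is * vandermonde x is ≡ Π₊ is
  Π₂-vandermonde [] = refl
  Π₂-vandermonde {i ∷ is} (i≢is ∷ distinct) = begin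
    ∏ is (ρ i) * Π₂ is * (∏ is (λ j → x j - x i) * vandermonde x is)
      ≡⟨ solve 4 (λ a b c d → a :* b :* (c :* d) := a :* c :* (b :* d)) refl
           (∏ is (ρ i)) (Π₂ is) (∏ is (λ j → x j - x i)) (vandermonde x is) ⟩
    ∏ is (ρ i) * ∏ is (λ j → x j - x i) * (Π₂ is * vandermonde x is)
      ≡⟨ cong₂ _*_ (sym (∏-* is (ρ i) (λ j → x j - x i))) (Π₂-vandermonde distinct) ⟩
    ∏ is (λ j → ρ i j * (x j - x i)) * Π₊ is
      ≡⟨ cong (_* Π₊ is) (∏-cong (All.map (λ {j} → cancel {j}) i≢is)) ⟩
    ∏ is (λ j → - 1ℚ * (x i + x j)) * Π₊ is ∎
    where
    cancel : ∀ {j} → x i ≢ x j → ρ i j * (x j - x i) ≡ - 1ℚ * (x i + x j)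
    cancel {j} xi≢xj = trans
      (solve 3 (λ r a b → r :* (b :- a) := con (- 1ℚ) :* (r :* (a :- b))) refl (ρ i j) (x i) (x j))
      (cong (- 1ℚ *_) (÷'-*-cancel (x i + x j) (λ eq → xi≢xj (x-y≡0⇒x≡y eq))))

-- Interpolation along the line (λ, t, 2t, ..., mt)

Pstar-interpolation : ∀ {μ lam f} → Poly (suc (sizeℕ μ)) f →
  (∀ a → let t = ℕ→ℚ (suc (part lam 0) ℕ.+ a) in formula μ (length lam ⊔ length μ) (pointAt lam t) ≡ f t) →
  Pstar μ lam ≡ f 0ℚ
Pstar-interpolation {μ} {lam} pf formula≡f = Interpolation.lagrangeAt0-poly (λ a → ℕ→ℚ (suc (part lam 0) ℕ.+ a))
  (λ eq → ℕ.+-cancelˡ-≡ (suc (part lam 0)) _ _ (ℕ→ℚ-injective eq))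
  {g = λ t → formula μ (length lam ⊔ length μ) (pointAt lam t)} pf formula≡f

pointAt-part : ∀ lam t {i} → i < length lam → pointAt lam t i ≡ ℕ→ℚ (part lam i)
pointAt-part lam t {i} i< with i ℕ.<? length lam
... | yes _ = refl
... | no i≮ = contradiction i< i≮

pointAt-0 : ∀ lam → pointAt lam 0ℚ (length lam) ≡ 0ℚ
pointAt-0 lam with length lam ℕ.<? length lam
... | yes n<n = contradiction n<n (ℕ.<-irrefl refl)
... | no _ = *-zeroˡ (ℕ→ℚ (suc (length lam ∸ length lam)))

pointAt-Linear : ∀ lam i → Linear (λ t → pointAt lam t i)
pointAt-Linear lam i with i ℕ.<? length lam
... | yes _ = Poly-const 1 (ℕ→ℚ (part lam i))
... | no _ = Poly-t* 1 (Poly-const 0 (ℕ→ℚ (suc (i ∸ length lam))))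

-- The parts of λ differ among themselves, every multiple of t exceeds λ_1, and different multiples
-- of t differ because t > 0.
pointAt-distinct : ∀ {lam t i j} → Decreasing lam → part lam 0 < t → i < j → pointAt lam (ℕ→ℚ t) i ≢ pointAt lam (ℕ→ℚ t) j
pointAt-distinct {lam} {t} {i} {j} dec lam₀<t i<j with i ℕ.<? length lam | j ℕ.<? length lam
... | yes i< | yes j< = ℕ.>⇒≢ (AllPairs-part dec i<j j<) ∘ ℕ→ℚ-injective
... | no i≮ | yes j< = contradiction (ℕ.<-trans i<j j<) i≮
... | yes i< | no j≮ = λ eq → ℕ.<⇒≢
  (ℕ.<-≤-trans (ℕ.≤-<-trans (part-antitone dec z≤n) lam₀<t) (ℕ.m≤m*n t (suc (j ∸ length lam))))
  (ℕ→ℚ-injective (trans eq (sym (ℕ→ℚ-* t (suc (j ∸ length lam))))))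
... | no i≮ | no j≮ = λ eq → ℕ.<⇒≢ (ℕ.*-monoʳ-< t {{ℕ.>-nonZero (ℕ.≤-<-trans z≤n lam₀<t)}}
    (s≤s (ℕ.∸-monoˡ-< i<j (ℕ.≮⇒≥ i≮))))
  (ℕ→ℚ-injective (trans (ℕ→ℚ-* t (suc (i ∸ length lam))) (trans eq (sym (ℕ→ℚ-* t (suc (j ∸ length lam)))))))

-- The value at λ = μ

Triangular-decreasing : ∀ x {μ} → Decreasing μ → ∀ h → (∀ {i} → i < length μ → x (h i) ≡ ℕ→ℚ (part μ i)) →
  Summand.Triangular x μ (applyUpTo h (length μ))
Triangular-decreasing x [] h eq = _
Triangular-decreasing x {m ∷ μ} (m> ∷ dec) h eq =
  -- The later coordinates are parts smaller than m, so their falling factorials with m factors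
  -- vanish.
  applyUpTo⁺₁ (h ∘ suc) (length μ) (λ i< → trans (cong (λ z → fall z m) (eq (s≤s i<))) (fall-zero (All-part m> i<))) ,
  Triangular-decreasing x dec (h ∘ suc) (eq ∘ s≤s)

summand-H : ∀ μ t → summand μ (length μ) (pointAt μ t) (upTo (length μ)) ≡ H μ
summand-H μ t = cong₂ _*_
  (∏-cong (All.map (λ {i} i< → trans (cong (λ z → fall z (part μ i)) (point i<)) (fall-self (part μ i))) (all-upTo l)))
  (∏-cong (All.map (λ {i} i< → ∏-cong (All.map
    (λ {j} j< → cong₂ (λ y z → (y + z) ÷' (y - z)) (point i<) (point j<)) (drop⁺ (suc i) (all-upTo l)))) (all-upTo l)))
  where
  l = length μ
  point : ∀ {i} → i < l → pointAt μ t (part (upTo l) i) ≡ ℕ→ℚ (part μ i)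
  point {i} i< = trans (cong (pointAt μ t) (part-upTo i<)) (pointAt-part μ t i<)

formula-H : ∀ {μ} → Decreasing μ → ∀ t → formula μ (length μ) (pointAt μ t) ≡ H μ
formula-H {μ} dec t = begin
  formula μ l x                       ≡⟨ formula-Chain μ ⟩
  Π₂ (upTo l) * Chain column (upTo l) μ    ≡⟨ Chain-triangular μ (upTo l) (Triangular-decreasing x dec (λ i → i) (pointAt-part μ t)) ⟩
  T μ (upTo l)                        ≡⟨ summand-T μ (upTo l) (length-upTo l) ⟨
  summand μ l x (upTo l)              ≡⟨ summand-H μ t ⟩
  H μ                                 ∎
  where
  l = length μ
  x = pointAt μ t
  open Summand x

-- No zero coordinates are appended when λ = μ, so the interpolated function takes the value H(μ) at
-- every node.
Pstar-self : ∀ {μ} → Decreasing μ → Pstar μ μ ≡ H μ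
Pstar-self {μ} dec = Pstar-interpolation {μ} {μ} {λ _ → H μ} (Poly-const (sizeℕ μ) (H μ))
  (λ a → trans (cong (λ n → formula μ n (pointAt μ (ℕ→ℚ (suc (part μ 0) ℕ.+ a)))) (ℕ.⊔-idem (length μ))) (formula-H dec _))

-- Vanishing when l(μ) ≤ l(λ)

formula-zero : ∀ μ n x → All (λ ω → summand μ n x ω ≡ 0ℚ) (Sym n) → formula μ n x ≡ 0ℚ
formula-zero μ n x zeros with n ℕ.<? length μ
... | yes _ = refl
... | no _ = trans (cong (1/[n-l]! *_) (∑-zero zeros)) (*-zeroʳ 1/[n-l]!)
  where 1/[n-l]! = 1ℚ ÷' ℕ→ℚ ((n ∸ length μ) !)

-- Here n = l(λ), so all coordinates are parts of λ and none depends on t. The position j from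
-- `permutation-exceeds` supplies the zero falling factorial.
summand-vanishing : ∀ {μ lam i} → Decreasing μ → Decreasing lam → length μ ℕ.≤ length lam → part lam i < part μ i →
  ∀ t {ω} → ω ↭ upTo (length lam) → summand μ (length lam) (pointAt lam t) ω ≡ 0ℚ
summand-vanishing {μ} {lam} {i} dμ dλ l≤k lamᵢ<μᵢ t {ω} p = trans (cong (_* pairs) (∏-zero
    (Any.applyUpTo⁺ (λ j → j) vanishes (ℕ.≤-<-trans j≤i i<l))))
  (*-zeroˡ pairs)
  where
  x = pointAt lam t
  pairs = ∏ (upTo (length μ)) (λ i → ∏ (drop (suc i) (upTo (length lam))) (λ j →
    (x (part ω i) + x (part ω j)) ÷' (x (part ω i) - x (part ω j))))
  i<l : i < length μ
  i<l = part-> μ (ℕ.≤-<-trans z≤n lamᵢ<μᵢ)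
  exceeds = permutation-exceeds {i = i} p (ℕ.<-≤-trans i<l l≤k)
  j = proj₁ exceeds
  j≤i = proj₁ (proj₂ exceeds)
  i≤ωj = proj₂ (proj₂ exceeds)
  ωj<k : part ω j < length lam
  ωj<k = All-part (All-resp-↭ (↭-sym p) (all-upTo (length lam)))
    (subst (j <_) (sym (trans (↭-length p) (length-upTo (length lam)))) (ℕ.≤-<-trans j≤i (ℕ.<-≤-trans i<l l≤k)))
  vanishes : fall (x (part ω j)) (part μ j) ≡ 0ℚ
  vanishes = trans (cong (λ z → fall z (part μ j)) (pointAt-part lam t ωj<k))
    (fall-zero (ℕ.≤-<-trans (part-antitone dλ i≤ωj) (ℕ.<-≤-trans lamᵢ<μᵢ (part-antitone dμ j≤i))))

Pstar-vanishing-≤ : ∀ {μ lam i} → Decreasing μ → Decreasing lam → length μ ℕ.≤ length lam → part lam i < part μ i →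
  Pstar μ lam ≡ 0ℚ
Pstar-vanishing-≤ {μ} {lam} dμ dλ l≤k lam<μ = Pstar-interpolation {μ} {lam} {λ _ → 0ℚ} (Poly-const (sizeℕ μ) 0ℚ)
  (λ a → trans (cong (λ n → formula μ n _) (ℕ.m≥n⇒m⊔n≡m l≤k))
    (formula-zero μ (length lam) _ (All.map (summand-vanishing dμ dλ l≤k lam<μ _) (perms-↭ (upTo (length lam))))))

-- Vanishing when l(μ) > l(λ)

positive⇒suc : ∀ {μ} → All (0 <_) μ → ∃ λ rs → μ ≡ map suc rs
positive⇒suc [] = [] , refl
positive⇒suc {suc r ∷ _} (_ ∷ pos) with positive⇒suc pos
... | rs , refl = r ∷ rs , refl

sizeℕ-map-suc : ∀ rs → sizeℕ (map suc rs) ≡ length (map suc rs) ℕ.+ sizeℕ rs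
sizeℕ-map-suc [] = refl
sizeℕ-map-suc (r ∷ rs) = cong suc (trans (cong (r ℕ.+_) (sizeℕ-map-suc rs)) (x∙yz≈y∙xz r (length (map suc rs)) (sizeℕ rs)))

-- The defining formula with its denominators cancelled, for μ = `map suc rs`. It agrees with
-- `formula` at distinct coordinates and is a polynomial along the whole line, including t = 0.
polynomialFormula : (ℕ → ℚ) → List ℕ → List ℕ → ℚ
polynomialFormula x is rs = ∏ is x * (Summand.Π₊ x is * newton x fallCoeffs is rs)

formula-polynomial : ∀ x rs → let n = length (map suc rs) in AllPairs (λ i j → x i ≢ x j) (upTo n) →
  formula (map suc rs) n x ≡ polynomialFormula x (upTo n) rs
formula-polynomial x rs distinct = begin
  formula (map suc rs) (length (map suc rs)) x
    ≡⟨ formula-Chain (map suc rs) ⟩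
  Π₂ is * Chain column is (map suc rs)
    ≡⟨ cong (Π₂ is *_) (trans (Chain-map suc column is rs) (trans (Chain-cong (λ i r → fall-suc (x i) r) is rs)
         (trans (Chain-scale x (λ i r → eval (fallCoeffs r) (x i)) is rs) (cong (∏ is x *_) (Chain-newton x fallCoeffs is rs))))) ⟩
  Π₂ is * (∏ is x * (vandermonde x is * N))
    ≡⟨ solve 4 (λ a b c d → a :* (b :* (c :* d)) := b :* (a :* c :* d)) refl (Π₂ is) (∏ is x) (vandermonde x is) N ⟩
  ∏ is x * (Π₂ is * vandermonde x is * N)
    ≡⟨ cong (λ z → ∏ is x * (z * N)) (Π₂-vandermonde distinct) ⟩
  ∏ is x * (Π₊ is * N) ∎
  where
  open Summand x
  is = upTo (length (map suc rs))
  N = newton x fallCoeffs is rs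

Poly-Π₊* : ∀ {x : ℚ → ℕ → ℚ} → (∀ i → Linear (λ t → x t i)) → ∀ is n {f} → Poly n f →
  Poly (tri (length is) ℕ.+ n) (λ t → Summand.Π₊ (x t) is * f t)
Poly-Π₊* lx [] n {f} pf = Poly-ext n (λ t → sym (*-identityˡ (f t))) pf
Poly-Π₊* {x} lx (i ∷ is) n {f} pf = Poly-ext (length is ℕ.+ tri (length is) ℕ.+ n)
  (λ t → sym (*-assoc (∏ is (λ j → - 1ℚ * (x t i + x t j))) (Summand.Π₊ (x t) is) (f t)))
  (subst (λ m → Poly m (λ t → ∏ is (λ j → - 1ℚ * (x t i + x t j)) * (Summand.Π₊ (x t) is * f t))) (sym (ℕ.+-assoc (length is) (tri (length is)) n))
    (Poly-∏* is (tri (length is) ℕ.+ n) (All.universal (λ j → Poly-scale 2 (- 1ℚ) (Poly-+ 2 (lx i) (lx j))) is) (Poly-Π₊* lx is n pf)))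

-- With l coordinates, the product of the x_i has degree at most l, `Π₊` at most `tri l`, and the
-- Newton determinant at most |rs| - `tri l` unless it vanishes identically. The total l + |rs| is
-- |μ| for the l parts r + 1.
Poly-polynomialFormula : ∀ {x : ℚ → ℕ → ℚ} → (∀ i → Linear (λ t → x t i)) → ∀ is rs →
  Poly (suc (length is ℕ.+ sizeℕ rs)) (λ t → polynomialFormula (x t) is rs)
Poly-polynomialFormula {x} lx is rs with newton-Deg x lx is 0 (λ _ → fallCoeffs) Coeffs-fallCoeffs rs
... | inj₁ N≡0 = Poly-zero _ (λ t → trans (cong (λ z → ∏ is (x t) * (Summand.Π₊ (x t) is * z)) (N≡0 t))
  (solve 2 (λ a b → a :* (b :* con 0ℚ) := con 0ℚ) refl (∏ is (x t)) (Summand.Π₊ (x t) is)))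
... | inj₂ (k , k≤ , pN) = Poly-mono degree (Poly-∏* is (tri l ℕ.+ suc k) (All.universal lx is) (Poly-Π₊* lx is (suc k) pN))
  where
  l = length is
  exchange : ∀ l w k → l ℕ.+ (w ℕ.+ suc k) ≡ suc (l ℕ.+ (k ℕ.+ w))
  exchange = solve-∀
  degree : l ℕ.+ (tri l ℕ.+ suc k) ℕ.≤ suc (l ℕ.+ sizeℕ rs)
  degree = subst (ℕ._≤ suc (l ℕ.+ sizeℕ rs)) (sym (exchange l (tri l) k))
    (s≤s (ℕ.+-monoʳ-≤ l (subst (λ e → k ℕ.+ e ℕ.≤ sizeℕ rs) (cong (ℕ._+ tri l) (ℕ.*-zeroʳ l)) k≤)))

Pstar-vanishing-> : ∀ {lam} rs → Decreasing lam → length lam < length (map suc rs) → Pstar (map suc rs) lam ≡ 0ℚ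
Pstar-vanishing-> {lam} rs dλ k<n = trans
  (Pstar-interpolation {map suc rs} {lam} {λ t → polynomialFormula (pointAt lam t) (upTo n) rs}
    (subst (λ m → Poly (suc m) (λ t → polynomialFormula (pointAt lam t) (upTo n) rs)) size
      (Poly-polynomialFormula (pointAt-Linear lam) (upTo n) rs))
    (λ a → trans (cong (λ m → formula (map suc rs) m _) (ℕ.m≤n⇒m⊔n≡n (ℕ.<⇒≤ k<n)))
      (formula-polynomial _ rs (AllPairs.applyUpTo⁺₁ (λ i → i) n
        (λ i<j _ → pointAt-distinct {lam} dλ (ℕ.m≤m+n (suc (part lam 0)) a) i<j)))))
  -- Since l(λ) < n, the product of all coordinates contains the first appended one, which is 0 at t
  -- = 0.
  (trans (cong (_* rest) (∏-zero (Any.applyUpTo⁺ (λ i → i) (pointAt-0 lam) k<n))) (*-zeroˡ rest))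
  where
  n = length (map suc rs)
  rest = Summand.Π₊ (pointAt lam 0ℚ) (upTo n) * newton (pointAt lam 0ℚ) fallCoeffs (upTo n) rs
  size : length (upTo n) ℕ.+ sizeℕ rs ≡ sizeℕ (map suc rs)
  size = trans (cong (ℕ._+ sizeℕ rs) (length-upTo n)) (sym (sizeℕ-map-suc rs))

theorem1p5 : (μ lam : List ℕ) → IsStrict μ → IsStrict lam →
    ((∃ λ i → part lam i < part μ i) → Pstar μ lam ≡ 0ℚ) × (Pstar μ μ ≡ H μ)
theorem1p5 μ lam sμ sλ = vanishing , Pstar-self (IsStrict⇒Decreasing sμ)
  where
  vanishing : (∃ λ i → part lam i < part μ i) → Pstar μ lam ≡ 0ℚ
  -- Positivity of the parts writes μ as `map suc rs`, which exposes the factor x of each falling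
  -- factorial in the second case.
  vanishing (i , lam<μ) with length μ ℕ.≤? length lam | positive⇒suc (proj₁ sμ)
  ... | yes l≤k | _ = Pstar-vanishing-≤ (IsStrict⇒Decreasing sμ) (IsStrict⇒Decreasing sλ) l≤k lam<μ
  ... | no l≰k | rs , refl = Pstar-vanishing-> rs (IsStrict⇒Decreasing sλ) (ℕ.≰⇒> l≰k)
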